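{- Let $p_0$ be an odd prime, $p$ a power of $p_0$, and $R(x) = 2x^p + x$. Let $\alpha \in \mathbb{F}_p^{\times} \setminus \{ -1\}$ and set $\beta = -(\alpha(\alpha+1))^{ -1} \in \mathbb{F}_p^\times$. Let $\xi, \zeta \in \mathbb{F}^{\times}$ satisfy $\xi^{p-1} = \alpha$ and $\zeta^{p-1} = \beta$. Let $d_1$ be the order of $\alpha$ in $\mathbb{F}_p^{\times}$, $d_2$ the order of $\beta$ in $\mathbb{F}_p^{\times}$, and $d = \mathrm{lcm}(d_1, d_2)$. Let $\overline{C}_{\zeta R}$ be the smooth projective compactification of the affine curve $y^p - y = \zeta x R(x) = 2\zeta x^{p+1} + \zeta x^2$, defined over $\mathbb{F}_p(\zeta)$. (1) If $d$ is odd and $p \equiv 3 \pmod 4$, then $\overline{C}_{\zeta R}$ is $\mathbb{F}_{p^{2p_0 d}}$-maximal. (2) If $d$ is even and $\beta^{d/2} = -1$, then $\overline{C}_{\zeta R}$ is $\mathbb{F}_{p^{p_0 d}}$-maximal.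
   Context: $\mathbb{F}$ denotes an algebraic closure of $\mathbb{F}_{p_0}$; one has $\zeta \in \mathbb{F}_{p^d}$. The curve $\overline{C}_{\zeta R}$ is geometrically connected, smooth, projective of genus $g = p(p-1)/2$. For a power $Q$ of $p$ with $\mathbb{F}_p(\zeta) \subset \mathbb{F}_Q$, the curve is called $\mathbb{F}_Q$-maximal if $|\overline{C}_{\zeta R}(\mathbb{F}_Q)| = Q + 1 + 2gQ^{1/2}$. -}

module Defs where

open import Level using (Level; _⊔_; suc)
open import Data.Nat using (ℕ; zero; suc; _≤_; _<_)
import Data.Nat as N
open import Data.Fin using (Fin)
import Data.Fin as Fin
open import Data.Bool using (Bool; true; false; if_then_else_)
open import Data.Product using (Σ; _×_; _,_)
open import Relation.Nullary using (¬_; Dec)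
open import Relation.Nullary.Decidable using (⌊_⌋)
open import Relation.Binary.PropositionalEquality using (_≡_)
open import Algebra.Bundles using (CommutativeRing)

record FiniteField (c ℓ : Level) : Set (Level.suc (c ⊔ ℓ)) where
  field
    commRing : CommutativeRing c ℓ
  open CommutativeRing commRing public hiding (ring)
  field
    _≟_       : (x y : Carrier) → Dec (x ≈ y)
    0≉1       : ¬ (0# ≈ 1#)
    inv       : Carrier → Carrier
    inv-r     : (x : Carrier) → ¬ (x ≈ 0#) → x * inv x ≈ 1#
    size      : ℕ
    enum      : Fin size → Carrier
    enum-inj  : (i j : Fin size) → enum i ≈ enum j → i ≡ j
    enum-surj : (x : Carrier) → Σ (Fin size) (λ i → enum i ≈ x)

module _ {c ℓ : Level} (K : FiniteField c ℓ) where
  open FiniteField K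

  pow : Carrier → ℕ → Carrier
  pow x zero    = 1#
  pow x (suc n) = x * pow x n

  InFp : ℕ → Carrier → Set ℓ
  InFp p x = pow x p ≈ x

  IsOrder : Carrier → ℕ → Set ℓ
  IsOrder x n = (1 ≤ n) × (pow x n ≈ 1#) ×
                ((m : ℕ) → 1 ≤ m → m < n → ¬ (pow x m ≈ 1#))

  betaOf : Carrier → Carrier
  betaOf α = - inv (α * (α + 1#))

  Rpoly : ℕ → Carrier → Carrier
  Rpoly p x = ((1# + 1#) * pow x p) + x

  onCurve : ℕ → Carrier → Carrier → Carrier → Bool
  onCurve p ζ x y = ⌊ (pow y p - y) ≟ (ζ * (x * Rpoly p x)) ⌋

  affineCount : ℕ → Carrier → ℕ
  affineCount p ζ = countFin size (λ i → countFin size (λ j →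
                      if onCurve p ζ (enum i) (enum j) then 1 else 0))
    where
    countFin : (n : ℕ) → (Fin n → ℕ) → ℕ
    countFin zero    f = 0
    countFin (suc n) f = f Fin.zero N.+ countFin n (λ k → f (Fin.suc k))

  -- number of K-rational points of the smooth projective model \bar C_{ζR}:
  -- affine points plus the unique (K-rational) point at infinity
  -- (deg ζxR(x) = p+1 is prime to p, so ∞ is totally ramified).
  projCount : ℕ → Carrier → ℕ
  projCount p ζ = affineCount p ζ N.+ 1

  genus : ℕ → ℕ
  genus p = (p N.* (p N.∸ 1)) N./ 2

  Maximal : ℕ → Carrier → ℕ → Set
  Maximal p ζ sqrtQ = projCount p ζ ≡ size N.+ 1 N.+ 2 N.* genus p N.* sqrtQ

{-# OPTIONS --safe #-}
module Submission where

-- Let F be the p-power map, T the trace to F_p, and choose ξ with F ξ = α ξ, c = ζ ξ². Substituting x = ξ u,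
-- T (ζ x R(x)) = − α T (c (F u − u)²), and y^p − y = b has p solutions if T b = 0 and none otherwise. So
-- the curve has p² #{v : T v = 0, T (c v²) = 0} affine points. As F c ∈ F_p c with multiplier of order
-- dividing [K : F_p] / p₀, T (1/c) = 0; thus 1/c is isotropic for T (c v²) and T v = 0 is its orthogonal
-- complement, which reduces the count to the zeros of T (c v²) on all of K. With r = √|K|, after scaling v the
-- coefficient satisfies c^r = − c, so that F_r is isotropic and its own orthogonal complement: the form is hyperbolic.

open import Defs
open import Level using (Level; _⊔_)
open import Algebra.Bundles using (CommutativeMonoid; CommutativeRing)
import Algebra.Properties.CommutativeMonoid.Sum as Sum
import Algebra.Solver.Ring as RingSolver
open import Algebra.Solver.Ring.AlmostCommutativeRing using (fromCommutativeRing; _-Raw-AlmostCommutative⟶_)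
open import Data.Bool using (if_then_else_)
open import Data.Fin as Fin using (Fin; zero; suc)
open import Data.Fin.Permutation using (Permutation; permutation)
import Data.Fin.Properties as Fin
open import Data.Integer as ℤ using (ℤ; +_; -[1+_])
import Data.Integer.Properties as ℤ
import Data.Maybe as Maybe
open import Data.Nat as ℕ using (ℕ; zero; suc; _≤_; _<_; z≤n; s≤s)
open import Data.Nat.Combinatorics using (_C_; nCn≡1; nC1≡n; k>n⇒nCk≡0; nCk+nC[k+1]≡[n+1]C[k+1])
open import Data.Nat.Divisibility as ℕ using (_∣_; divides)
import Data.Nat.DivMod as ℕ
open import Data.Nat.LCM using (lcm; m∣lcm[m,n]; n∣lcm[m,n])
open import Data.Nat.Primality using (Prime; euclidsLemma; prime⇒nonTrivial)
import Data.Nat.Properties as ℕ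
open import Data.Nat.Tactic.RingSolver using (solve-∀)
open import Data.Product using (∃; _×_; _,_; proj₁; proj₂)
open import Data.Sum using (inj₁; inj₂)
open import Function using (_∘_; id)
open import Relation.Binary.Core using (_Preserves_⟶_)
open import Relation.Binary.PropositionalEquality as ≡ using (_≡_; _≢_)
open import Relation.Nullary using (¬_; Dec; yes; no; contradiction)
open import Relation.Nullary.Decidable using (⌊_⌋; map′; ¬?; _×-dec_; decidable-stable; dec⇒maybe)

-- No characters or Gauss sums occur: facts about quadratic forms are equalities of natural numbers,
-- obtained by averaging over the translates of an isotropic subspace. An element ξ in K is not
-- given but constructed, as a non-zero value of a twisted trace. The two cases differ only in the
-- scaling that makes c^r = - c. With r = p^s, the r-power map multiplies c by β^s α^(2s) = β^s. For
-- even d this is already - 1. For odd d it is 1, so a k with (k²)^r = - k² is required; it is a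
-- power of a non-square and exists because r is 3 modulo 4, which is where p ≡ 3 (mod 4) enters.
-- Hyperbolicity of the form is what gives the sign + in front of 2g√Q, hence a maximal curve rather
-- than a minimal one.

module IntegerSolver {c ℓ} (K : CommutativeRing c ℓ) where
  open CommutativeRing K
  open import Algebra.Properties.Ring ring
  open import Algebra.Properties.AbelianGroup +-abelianGroup using (⁻¹-∙-comm)
  open import Algebra.Properties.Group +-group using (ε⁻¹≈ε; ⁻¹-involutive)
  open import Algebra.Properties.Semiring.Mult.TCOptimised semiring using (×-homo-+; ×1-homo-*; 1+×) renaming (_×_ to _·_)
  open import Relation.Binary.Reasoning.Setoid setoid

  -- With this version of the multiple, the constants 1 and 2 of the solver evaluate to `1#` and
  -- `1# + 1#` by definition, so solved identities apply directly to terms such as `Rpoly`.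
  fromℤ : ℤ → Carrier
  fromℤ (+ n)    = n · 1#
  fromℤ -[1+ n ] = - (suc n · 1#)

  fromℤ-⊖ : ∀ m n → fromℤ (m ℤ.⊖ n) ≈ m · 1# + - (n · 1#)
  fromℤ-⊖ zero zero = sym (-‿inverseʳ _)
  fromℤ-⊖ zero (suc n) = sym (+-identityˡ _)
  fromℤ-⊖ (suc m) zero = sym (trans (+-congˡ ε⁻¹≈ε) (+-identityʳ _))
  fromℤ-⊖ (suc m) (suc n) = begin
    fromℤ (suc m ℤ.⊖ suc n)                    ≡⟨ ≡.cong fromℤ (ℤ.[1+m]⊖[1+n]≡m⊖n m n) ⟩
    fromℤ (m ℤ.⊖ n)                            ≈⟨ fromℤ-⊖ m n ⟩
    m · 1# + - (n · 1#)                        ≈⟨ +-congʳ (+-identityˡ _) ⟨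
    (0# + m · 1#) + - (n · 1#)                 ≈⟨ +-congʳ (+-congʳ (-‿inverseʳ 1#)) ⟨
    ((1# + - 1#) + m · 1#) + - (n · 1#)        ≈⟨ +-congʳ (+-assoc _ _ _) ⟩
    (1# + (- 1# + m · 1#)) + - (n · 1#)        ≈⟨ +-congʳ (+-congˡ (+-comm _ _)) ⟩
    (1# + (m · 1# + - 1#)) + - (n · 1#)        ≈⟨ +-congʳ (+-assoc _ _ _) ⟨
    ((1# + m · 1#) + - 1#) + - (n · 1#)        ≈⟨ +-assoc _ _ _ ⟩
    (1# + m · 1#) + (- 1# + - (n · 1#))        ≈⟨ +-cong (sym (1+× m 1#)) (trans (⁻¹-∙-comm _ _) (-‿cong (sym (1+× n 1#)))) ⟩
    suc m · 1# + - (suc n · 1#)                ∎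

  fromℤ-+ : ∀ i j → fromℤ (i ℤ.+ j) ≈ fromℤ i + fromℤ j
  fromℤ-+ (+ m) (+ n) = ×-homo-+ 1# m n
  fromℤ-+ (+ m) -[1+ n ] = fromℤ-⊖ m (suc n)
  fromℤ-+ -[1+ m ] (+ n) = trans (fromℤ-⊖ n (suc m)) (+-comm _ _)
  fromℤ-+ -[1+ m ] -[1+ n ] = trans
    (-‿cong (trans (reflexive (≡.cong (λ k → suc k · 1#) (≡.sym (ℕ.+-suc m n)))) (×-homo-+ 1# (suc m) (suc n))))
    (sym (⁻¹-∙-comm _ _))

  fromℤ-neg : ∀ i → fromℤ (ℤ.- i) ≈ - fromℤ i
  fromℤ-neg (+ zero)  = sym ε⁻¹≈ε
  fromℤ-neg (+ suc n) = refl
  fromℤ-neg -[1+ n ]  = sym (⁻¹-involutive _)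

  fromℤ-+* : ∀ m j → fromℤ (+ m ℤ.* j) ≈ m · 1# * fromℤ j
  fromℤ-+* m (+ n) = trans (reflexive (≡.cong fromℤ (≡.sym (ℤ.pos-* m n)))) (×1-homo-* m n)
  fromℤ-+* m -[1+ n ] = begin
    fromℤ (+ m ℤ.* -[1+ n ])         ≡⟨ ≡.cong fromℤ (ℤ.neg-distribʳ-* (+ m) (+ suc n)) ⟨
    fromℤ (ℤ.- (+ m ℤ.* + suc n))    ≈⟨ fromℤ-neg (+ m ℤ.* + suc n) ⟩
    - fromℤ (+ m ℤ.* + suc n)        ≈⟨ -‿cong (fromℤ-+* m (+ suc n)) ⟩
    - (m · 1# * (suc n · 1#))        ≈⟨ -‿distribʳ-* _ _ ⟩
    m · 1# * - (suc n · 1#)          ∎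

  fromℤ-* : ∀ i j → fromℤ (i ℤ.* j) ≈ fromℤ i * fromℤ j
  fromℤ-* (+ m) j = fromℤ-+* m j
  fromℤ-* -[1+ m ] j = begin
    fromℤ (-[1+ m ] ℤ.* j)           ≡⟨ ≡.cong fromℤ (ℤ.neg-distribˡ-* (+ suc m) j) ⟨
    fromℤ (ℤ.- (+ suc m ℤ.* j))      ≈⟨ fromℤ-neg (+ suc m ℤ.* j) ⟩
    - fromℤ (+ suc m ℤ.* j)          ≈⟨ -‿cong (fromℤ-+* (suc m) j) ⟩
    - (suc m · 1# * fromℤ j)         ≈⟨ -‿distribˡ-* _ _ ⟩
    - (suc m · 1#) * fromℤ j         ∎

  morphism : ℤ.+-*-rawRing -Raw-AlmostCommutative⟶ fromCommutativeRing K
  morphism = record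
    { ⟦_⟧ = fromℤ ; +-homo = fromℤ-+ ; *-homo = fromℤ-* ; -‿homo = fromℤ-neg
    ; 0-homo = refl ; 1-homo = refl }

  open RingSolver ℤ.+-*-rawRing (fromCommutativeRing K) morphism
    (λ i j → Maybe.map (λ e → reflexive (≡.cong fromℤ e)) (dec⇒maybe (i ℤ.≟ j)))
    public using (solve; con; _:=_; _:+_; _:*_; :-_; _:-_)

-- Indicators and finite sums of natural numbers.

module ℕΣ = Sum ℕ.+-0-commutativeMonoid
open ℕΣ using (sum)

module _ {a} {A : Set a} where

  -- The Iverson bracket, in the form in which `affineCount` weights its points, so that the two
  -- agree by definition.
  ⟦_⟧ : Dec A → ℕ
  ⟦ a? ⟧ = if ⌊ a? ⌋ then 1 else 0

  ⟦⟧-yes : (a? : Dec A) → A → ⟦ a? ⟧ ≡ 1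
  ⟦⟧-yes (yes _) _ = ≡.refl
  ⟦⟧-yes (no ¬a) a = contradiction a ¬a

  ⟦⟧-no : (a? : Dec A) → ¬ A → ⟦ a? ⟧ ≡ 0
  ⟦⟧-no (yes a) ¬a = contradiction a ¬a
  ⟦⟧-no (no _)  _  = ≡.refl

  ⟦⟧≤1 : (a? : Dec A) → ⟦ a? ⟧ ≤ 1
  ⟦⟧≤1 (yes _) = ℕ.≤-refl
  ⟦⟧≤1 (no _)  = z≤n

⟦⟧+⟦¬⟧ : ∀ {a} {A : Set a} (a? : Dec A) → ⟦ a? ⟧ ℕ.+ ⟦ ¬? a? ⟧ ≡ 1
⟦⟧+⟦¬⟧ (yes _) = ≡.refl
⟦⟧+⟦¬⟧ (no _)  = ≡.refl

module _ {a b} {A : Set a} {B : Set b} where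

  ⟦⟧-mono : (a? : Dec A) (b? : Dec B) → (A → B) → ⟦ a? ⟧ ≤ ⟦ b? ⟧
  ⟦⟧-mono (yes a) b? f = ℕ.≤-reflexive (≡.sym (⟦⟧-yes b? (f a)))
  ⟦⟧-mono (no _)  b? f = z≤n

⟦⟧-cong : ∀ {a b} {A : Set a} {B : Set b} (a? : Dec A) (b? : Dec B) →
          (A → B) → (B → A) → ⟦ a? ⟧ ≡ ⟦ b? ⟧
⟦⟧-cong a? b? f g = ℕ.≤-antisym (⟦⟧-mono a? b? f) (⟦⟧-mono b? a? g)

sum-mono-≤ : ∀ {n} {f g : Fin n → ℕ} → (∀ i → f i ≤ g i) → sum f ≤ sum g
sum-mono-≤ {zero}  f≤g = z≤n
sum-mono-≤ {suc n} f≤g = ℕ.+-mono-≤ (f≤g zero) (sum-mono-≤ (f≤g ∘ suc))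

-- One strict inequality would already separate the totals. This is how bounds on numbers of roots
-- become exact fibre sizes in `Exactness`.
sum-mono-≤-≡ : ∀ {n} {f g : Fin n → ℕ} → (∀ i → f i ≤ g i) → sum g ≤ sum f → ∀ i → f i ≡ g i
sum-mono-≤-≡ {suc n} {f} {g} f≤g ∑g≤∑f zero = ℕ.≤-antisym (f≤g zero)
  (ℕ.+-cancelʳ-≤ (sum (f ∘ suc)) (g zero) (f zero)
    (ℕ.≤-trans (ℕ.+-monoʳ-≤ (g zero) (sum-mono-≤ (f≤g ∘ suc))) ∑g≤∑f))
sum-mono-≤-≡ {suc n} {f} {g} f≤g ∑g≤∑f (suc i) = sum-mono-≤-≡ (f≤g ∘ suc)
  (ℕ.+-cancelˡ-≤ (f zero) _ _ (ℕ.≤-trans (ℕ.+-monoˡ-≤ _ (f≤g zero)) ∑g≤∑f)) i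

sum-zero : ∀ {n} {f : Fin n → ℕ} → (∀ i → f i ≡ 0) → sum f ≡ 0
sum-zero {n} f≡0 = ≡.trans (ℕΣ.sum-cong-≗ {n} f≡0) (ℕΣ.sum-replicate-zero n)

sum-*ˡ : ∀ {n} k (f : Fin n → ℕ) → sum (λ i → k ℕ.* f i) ≡ k ℕ.* sum f
sum-*ˡ {zero}  k f = ≡.sym (ℕ.*-zeroʳ k)
sum-*ˡ {suc n} k f = ≡.trans (≡.cong (k ℕ.* f zero ℕ.+_) (sum-*ˡ k (f ∘ suc)))
  (≡.sym (ℕ.*-distribˡ-+ k (f zero) _))

sum-const : ∀ n k → sum {n} (λ _ → k) ≡ n ℕ.* k
sum-const zero    k = ≡.refl
sum-const (suc n) k = ≡.cong (k ℕ.+_) (sum-const n k)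

sum-supported : ∀ {n} (f : Fin n → ℕ) k → (∀ i → i ≢ k → f i ≡ 0) → sum f ≡ f k
sum-supported {suc n} f zero f≡0 = ≡.trans
  (≡.cong (f zero ℕ.+_) (sum-zero λ i → f≡0 (suc i) λ ())) (ℕ.+-identityʳ _)
sum-supported {suc n} f (suc k) f≡0 = ≡.trans
  (≡.cong (ℕ._+ sum (f ∘ suc)) (f≡0 zero λ ()))
  (sum-supported (f ∘ suc) k λ i i≢k → f≡0 (suc i) (i≢k ∘ Fin.suc-injective))

-- Sums over the elements of a finite field.

module FieldSums {c ℓ} (K : FiniteField c ℓ) where
  open FiniteField K

  index : Carrier → Fin size
  index x = proj₁ (enum-surj x)

  enum-index : ∀ x → enum (index x) ≈ x
  enum-index x = proj₂ (enum-surj x)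

  index-cong : ∀ {i x} → enum i ≈ x → index x ≡ i
  index-cong {i} {x} eq = enum-inj _ _ (trans (enum-index x) (sym eq))

  any-dec : ∀ {p} {P : Carrier → Set p} → (∀ {x y} → x ≈ y → P x → P y) →
            (∀ x → Dec (P x)) → Dec (∃ P)
  any-dec P-resp P? = map′ (λ (i , pi) → enum i , pi)
    (λ (x , px) → index x , P-resp (sym (enum-index x)) px) (Fin.any? (P? ∘ enum))

  reindexing : ∀ {σ τ} → σ Preserves _≈_ ⟶ _≈_ → τ Preserves _≈_ ⟶ _≈_ →
               (∀ x → σ (τ x) ≈ x) → (∀ x → τ (σ x) ≈ x) → Permutation size size
  reindexing {σ} {τ} σ-cong τ-cong στ τσ = permutation
    (index ∘ σ ∘ enum) (index ∘ τ ∘ enum)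
    (λ j → index-cong (sym (trans (σ-cong (enum-index _)) (στ _))))
    (λ j → index-cong (sym (trans (τ-cong (enum-index _)) (τσ _))))

  module _ {a r} (M : CommutativeMonoid a r) where
    private module M = CommutativeMonoid M
    open Sum M renaming (sum to sumM)

    -- Stated for any commutative monoid because it serves for counts in ℕ, for the product of the
    -- units and for the sum of all field elements.
    sum-reindex : ∀ {f} → f Preserves _≈_ ⟶ M._≈_ →
      ∀ {σ τ} → σ Preserves _≈_ ⟶ _≈_ → τ Preserves _≈_ ⟶ _≈_ →
      (∀ x → σ (τ x) ≈ x) → (∀ x → τ (σ x) ≈ x) →
      sumM (f ∘ enum) M.≈ sumM (f ∘ σ ∘ enum)
    sum-reindex {f} f-cong {σ} σ-cong τ-cong στ τσ = M.trans
      (sum-permute (f ∘ enum) (reindexing σ-cong τ-cong στ τσ))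
      (sum-cong-≋ {size} λ i → f-cong (enum-index (σ (enum i))))

  -- Opaque so that the summand can be inferred from a sum.
  opaque
    ∑ : (Carrier → ℕ) → ℕ
    ∑ f = sum (f ∘ enum)

    ∑-cong : ∀ {f g} → (∀ x → f x ≡ g x) → ∑ f ≡ ∑ g
    ∑-cong f≡g = ℕΣ.sum-cong-≗ {size} (f≡g ∘ enum)

    ∑-mono-≤ : ∀ {f g} → (∀ x → f x ≤ g x) → ∑ f ≤ ∑ g
    ∑-mono-≤ f≤g = sum-mono-≤ (f≤g ∘ enum)

    ∑-mono-≤-≡ : ∀ {f g} → f Preserves _≈_ ⟶ _≡_ → g Preserves _≈_ ⟶ _≡_ →
                  (∀ x → f x ≤ g x) → ∑ g ≤ ∑ f → ∀ x → f x ≡ g x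
    ∑-mono-≤-≡ f-cong g-cong f≤g ∑g≤∑f x = ≡.trans (f-cong (sym (enum-index x)))
      (≡.trans (sum-mono-≤-≡ (f≤g ∘ enum) ∑g≤∑f (index x)) (g-cong (enum-index x)))

    ∑-+ : ∀ f g → ∑ (λ x → f x ℕ.+ g x) ≡ ∑ f ℕ.+ ∑ g
    ∑-+ f g = ℕΣ.∑-distrib-+ (f ∘ enum) (g ∘ enum)

    ∑-*ˡ : ∀ k f → ∑ (λ x → k ℕ.* f x) ≡ k ℕ.* ∑ f
    ∑-*ˡ k f = sum-*ˡ k (f ∘ enum)

    ∑-const : ∀ k → ∑ (λ _ → k) ≡ size ℕ.* k
    ∑-const = sum-const size

    ∑-swap : ∀ (f : Carrier → Carrier → ℕ) → ∑ (λ x → ∑ (λ y → f x y)) ≡ ∑ (λ y → ∑ (λ x → f x y))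
    ∑-swap f = ℕΣ.∑-comm {size} {size} λ i j → f (enum i) (enum j)

    ∑-reindex : ∀ {f} → f Preserves _≈_ ⟶ _≡_ →
      ∀ {σ τ} → σ Preserves _≈_ ⟶ _≈_ → τ Preserves _≈_ ⟶ _≈_ →
      (∀ x → σ (τ x) ≈ x) → (∀ x → τ (σ x) ≈ x) → ∑ f ≡ ∑ (f ∘ σ)
    ∑-reindex = sum-reindex ℕ.+-0-commutativeMonoid

    ∑-supported : ∀ {f} → f Preserves _≈_ ⟶ _≡_ → ∀ a → (∀ x → ¬ x ≈ a → f x ≡ 0) → ∑ f ≡ f a
    ∑-supported {f} f-cong a f≡0 = ≡.trans
      (sum-supported (f ∘ enum) (index a)
        λ i i≢a → f≡0 (enum i) λ eq → i≢a (≡.sym (index-cong eq)))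
      (f-cong (enum-index a))

  ∑-singleton : ∀ {p} {P : Carrier → Set p} (P? : ∀ x → Dec (P x)) a →
                (∀ {x} → P x → x ≈ a) → (∀ {x} → x ≈ a → P x) → ∑ (λ x → ⟦ P? x ⟧) ≡ 1
  ∑-singleton P? a to from = ≡.trans
    (∑-cong λ x → ⟦⟧-cong (P? x) (x ≟ a) to from)
    (≡.trans (∑-supported (λ x≈y → ⟦⟧-cong (_ ≟ a) (_ ≟ a) (trans (sym x≈y)) (trans x≈y)) a
       (λ x x≉a → ⟦⟧-no (x ≟ a) x≉a))
     (⟦⟧-yes (a ≟ a) refl))

-- The point count as a double sum of indicators.

pointIndicator : ∀ {c ℓ} (K : FiniteField c ℓ) → let open FiniteField K in
                 ℕ → Carrier → Carrier → Carrier → ℕ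
pointIndicator K p ζ x y = if onCurve K p ζ x y then 1 else 0

-- The summation inside affineCount is a local definition without an accessible name. It is recovered by
-- unification, once the size and the summand are generalised so that it occurs applied to distinct variables.
mutual
  countFin : ∀ {c ℓ} (K : FiniteField c ℓ) (p : ℕ) (ζ : FiniteField.Carrier K) (n : ℕ) → (Fin n → ℕ) → ℕ
  countFin K p ζ n f = _

  countFin-solved : ∀ {c ℓ} (K : FiniteField c ℓ) (p : ℕ) (ζ : FiniteField.Carrier K) →
                    affineCount K p ζ ≡ affineCount K p ζ
  countFin-solved K p ζ with FiniteField.size K | FiniteField.enum K
  ... | zero  | e = ≡.refl
  ... | suc n | e with (λ j → pointIndicator K p ζ (e zero) (e (suc j)))
  ... | f = unify _
    where
    unify : ∀ z → let m = pointIndicator K p ζ (e zero) (e zero) ℕ.+ countFin K p ζ n f in m ℕ.+ z ≡ m ℕ.+ z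
    unify z = ≡.refl

module _ {c ℓ} (K : FiniteField c ℓ) (p : ℕ) (ζ : FiniteField.Carrier K) where
  open FiniteField K hiding (zero)
  open FieldSums K

  countFin≡sum : ∀ n f → countFin K p ζ n f ≡ sum f
  countFin≡sum zero    f = ≡.refl
  countFin≡sum (suc n) f = ≡.cong (f zero ℕ.+_) (countFin≡sum n (f ∘ suc))

  opaque
    unfolding ∑

    affineCount≡∑ : affineCount K p ζ ≡ ∑ (λ x → ∑ (λ y → ⟦ (pow K y p - y) ≟ (ζ * (x * Rpoly K p x)) ⟧))
    affineCount≡∑ = ≡.trans
      (countFin≡sum size (λ i → countFin K p ζ size (λ j → pointIndicator K p ζ (enum i) (enum j))))
      (ℕΣ.sum-cong-≗ {size} λ i → countFin≡sum size (λ j → pointIndicator K p ζ (enum i) (enum j)))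

-- Binomial coefficients modulo a prime, and parity.

C-absorption : ∀ n k → suc k ℕ.* (suc n C suc k) ≡ suc n ℕ.* (n C k)
C-absorption n zero = ≡.trans (ℕ.+-identityʳ (suc n C 1)) (≡.trans (nC1≡n (suc n)) (≡.sym (ℕ.*-identityʳ (suc n))))
C-absorption zero (suc k) = ≡.trans (≡.cong (suc (suc k) ℕ.*_) (k>n⇒nCk≡0 {1} {suc (suc k)} (s≤s (s≤s z≤n))))
  (ℕ.*-zeroʳ k)
C-absorption (suc n) (suc k) = begin
  suc (suc k) ℕ.* (suc (suc n) C suc (suc k))
    ≡⟨ ≡.cong (suc (suc k) ℕ.*_) (nCk+nC[k+1]≡[n+1]C[k+1] (suc n) (suc k)) ⟨
  suc (suc k) ℕ.* (a ℕ.+ b)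
    ≡⟨ expand k a b ⟩
  a ℕ.+ suc k ℕ.* a ℕ.+ suc (suc k) ℕ.* b
    ≡⟨ ≡.cong₂ (λ u v → a ℕ.+ u ℕ.+ v) (C-absorption n k) (C-absorption n (suc k)) ⟩
  a ℕ.+ suc n ℕ.* (n C k) ℕ.+ suc n ℕ.* (n C suc k)
    ≡⟨ collect n a (n C k) (n C suc k) ⟩
  a ℕ.+ suc n ℕ.* (n C k ℕ.+ n C suc k)
    ≡⟨ ≡.cong (λ u → a ℕ.+ suc n ℕ.* u) (nCk+nC[k+1]≡[n+1]C[k+1] n k) ⟩
  suc (suc n) ℕ.* a ∎
  where
  open ≡.≡-Reasoning
  a = suc n C suc k
  b = suc n C suc (suc k)
  expand : ∀ k a b → suc (suc k) ℕ.* (a ℕ.+ b) ≡ a ℕ.+ suc k ℕ.* a ℕ.+ suc (suc k) ℕ.* b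
  expand = solve-∀
  collect : ∀ n a c d → a ℕ.+ suc n ℕ.* c ℕ.+ suc n ℕ.* d ≡ a ℕ.+ suc n ℕ.* (c ℕ.+ d)
  collect = solve-∀

-- By absorption `p` divides (k + 1) · C(p, k + 1), and it cannot divide the smaller positive factor
-- k + 1.
prime∣C : ∀ {p} → Prime p → ∀ k → suc k < p → p ∣ p C suc k
prime∣C {suc p} p-prime k k<p with euclidsLemma (suc k) (suc p C suc k) p-prime
    (divides (p C k) (≡.trans (C-absorption p k) (ℕ.*-comm (suc p) (p C k))))
... | inj₁ p∣k = contradiction (ℕ.∣⇒≤ p∣k) (ℕ.<⇒≱ k<p)
... | inj₂ p∣C = p∣C

odd-decomposition : ∀ {n} → ¬ 2 ∣ n → ∃ λ h → n ≡ suc (h ℕ.* 2)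
odd-decomposition {n} 2∤n with n ℕ.% 2 in eq | ℕ.m≡m%n+[m/n]*n n 2 | ℕ.m%n<n n 2
... | 0 | n≡ | _ = contradiction (divides (n ℕ./ 2) n≡) 2∤n
... | 1 | n≡ | _ = n ℕ./ 2 , n≡
... | suc (suc _) | _ | s≤s (s≤s ())

-- Field arithmetic: Fermat's theorem, the characteristic, additivity of the Frobenius map.

module FieldArithmetic {c ℓ} (K : FiniteField c ℓ) where
  open FiniteField K hiding (zero)
  open FieldSums K
  open IntegerSolver commRing
  open import Algebra.Properties.Ring (CommutativeRing.ring commRing) using (-‿distribˡ-*; -‿distribʳ-*; -0#≈0#; -‿involutive) public
  open import Algebra.Properties.CommutativeSemiring.Exp commutativeSemiring public
  open import Algebra.Properties.Semiring.Mult semiring public using (×1-homo-*; ×-assocˡ; ×-congʳ; ×-assoc-*) renaming (_×_ to _·_)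
  open import Relation.Binary.Reasoning.Setoid setoid

  pow≡^ : ∀ x n → pow K x n ≡ x ^ n
  pow≡^ x zero    = ≡.refl
  pow≡^ x (suc n) = ≡.cong (x *_) (pow≡^ x n)

  pow⇒^ : ∀ {x y} n → pow K x n ≈ y → x ^ n ≈ y
  pow⇒^ n = trans (reflexive (≡.sym (pow≡^ _ n)))

  1≉0 : ¬ 1# ≈ 0#
  1≉0 = 0≉1 ∘ sym

  inv-l : ∀ x → ¬ x ≈ 0# → inv x * x ≈ 1#
  inv-l x x≉0 = trans (*-comm _ _) (inv-r x x≉0)

  *-cancelˡ-≉0 : ∀ {a x y} → ¬ a ≈ 0# → a * x ≈ a * y → x ≈ y
  *-cancelˡ-≉0 {a} {x} {y} a≉0 ax≈ay = begin
    x                ≈⟨ *-identityˡ x ⟨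
    1# * x           ≈⟨ *-congʳ (inv-l a a≉0) ⟨
    inv a * a * x    ≈⟨ *-assoc _ _ _ ⟩
    inv a * (a * x)  ≈⟨ *-congˡ ax≈ay ⟩
    inv a * (a * y)  ≈⟨ *-assoc _ _ _ ⟨
    inv a * a * y    ≈⟨ *-congʳ (inv-l a a≉0) ⟩
    1# * y           ≈⟨ *-identityˡ y ⟩
    y                ∎

  x*y≈0⇒y≈0 : ∀ {x y} → ¬ x ≈ 0# → x * y ≈ 0# → y ≈ 0#
  x*y≈0⇒y≈0 {x} x≉0 xy≈0 = *-cancelˡ-≉0 x≉0 (trans xy≈0 (sym (zeroʳ x)))

  *-≉0 : ∀ {x y} → ¬ x ≈ 0# → ¬ y ≈ 0# → ¬ x * y ≈ 0#
  *-≉0 x≉0 y≉0 = y≉0 ∘ x*y≈0⇒y≈0 x≉0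

  ^-≉0 : ∀ {x} n → ¬ x ≈ 0# → ¬ x ^ n ≈ 0#
  ^-≉0 zero    x≉0 = 1≉0
  ^-≉0 (suc n) x≉0 = *-≉0 x≉0 (^-≉0 n x≉0)

  x-y≈0⇒x≈y : ∀ {x y} → x - y ≈ 0# → x ≈ y
  x-y≈0⇒x≈y {x} {y} eq = begin
    x              ≈⟨ solve 2 (λ x y → x := (x :- y) :+ y) refl x y ⟩
    (x - y) + y    ≈⟨ +-congʳ eq ⟩
    0# + y         ≈⟨ +-identityˡ y ⟩
    y              ∎

  x≈y⇒x-y≈0 : ∀ {x y} → x ≈ y → x - y ≈ 0#
  x≈y⇒x-y≈0 {x} {y} eq = trans (+-congʳ eq) (-‿inverseʳ y)

  x+y≈0⇒x≈-y : ∀ {x y} → x + y ≈ 0# → x ≈ - y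
  x+y≈0⇒x≈-y {x} {y} eq = x-y≈0⇒x≈y (trans (+-congˡ (-‿involutive y)) eq)

  1^n≈1 : ∀ n → 1# ^ n ≈ 1#
  1^n≈1 zero    = refl
  1^n≈1 (suc n) = trans (*-identityˡ _) (1^n≈1 n)

  0^n≈0 : ∀ n → .{{ℕ.NonZero n}} → 0# ^ n ≈ 0#
  0^n≈0 (suc n) = zeroˡ _

  x^∣≈1 : ∀ {x m n} → m ∣ n → x ^ m ≈ 1# → x ^ n ≈ 1#
  x^∣≈1 {x} {m} (divides q ≡.refl) x^m≈1 = begin
    x ^ (q ℕ.* m)  ≡⟨ ≡.cong (x ^_) (ℕ.*-comm q m) ⟩
    x ^ (m ℕ.* q)  ≈⟨ ^-assocʳ x m q ⟨
    (x ^ m) ^ q    ≈⟨ ^-congˡ q x^m≈1 ⟩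
    1# ^ q         ≈⟨ 1^n≈1 q ⟩
    1#             ∎

  inv-^-fixed : ∀ {x} n → ¬ x ≈ 0# → x ^ n ≈ x → inv x ^ n ≈ inv x
  inv-^-fixed {x} n x≉0 xⁿ≈x = *-cancelˡ-≉0 x≉0 (begin
    x * inv x ^ n      ≈⟨ *-congʳ xⁿ≈x ⟨
    x ^ n * inv x ^ n  ≈⟨ ^-distrib-* _ _ n ⟨
    (x * inv x) ^ n    ≈⟨ ^-congˡ n (inv-r x x≉0) ⟩
    1# ^ n             ≈⟨ 1^n≈1 n ⟩
    1#                 ≈⟨ inv-r x x≉0 ⟨
    x * inv x          ∎)

  AdditivePower : ℕ → Set (c ⊔ ℓ)
  AdditivePower n = ∀ x y → (x + y) ^ n ≈ x ^ n + y ^ n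

  CharNot2 : Set ℓ
  CharNot2 = ¬ 1# + 1# ≈ 0#

  module ∏ = Sum *-commutativeMonoid

  ∏-≉0 : ∀ {n} (f : Fin n → Carrier) → (∀ i → ¬ f i ≈ 0#) → ¬ ∏.sum f ≈ 0#
  ∏-≉0 {zero}  f f≉0 = 1≉0
  ∏-≉0 {suc n} f f≉0 = *-≉0 (f≉0 zero) (∏-≉0 (f ∘ suc) (f≉0 ∘ suc))

  ∏-^ : ∀ {n} a (e : Fin n → ℕ) → ∏.sum (λ i → a ^ e i) ≈ a ^ ℕΣ.sum e
  ∏-^ {zero}  a e = refl
  ∏-^ {suc n} a e = trans (*-congˡ (∏-^ a (e ∘ suc))) (sym (^-homo-* a (e zero) _))

  -- Multiplication by a permutes the non-zero elements, so their product P satisfies P = a^(size-1) P.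
  x^size≈x : ∀ a → a ^ size ≈ a
  x^size≈x a with a ≟ 0#
  ... | yes a≈0 = trans (^-congˡ size a≈0) (trans (0^size size (index 0#)) (sym a≈0))
    where
    0^size : ∀ n → Fin n → 0# ^ n ≈ 0#
    0^size (suc n) _ = zeroˡ _
  ... | no a≉0 = begin
    a ^ size                 ≡⟨ ≡.cong (a ^_) (≡.sym size≡1+units) ⟩
    a * a ^ ∑ (λ x → ⟦ nonzero? x ⟧)    ≈⟨ *-congˡ a^units≈1 ⟩
    a * 1#                   ≈⟨ *-identityʳ a ⟩
    a                        ∎
    where
    nonzero? : ∀ x → Dec (¬ x ≈ 0#)
    nonzero? x = ¬? (x ≟ 0#)

    -- Zero is replaced by 1, so that the product over the whole enumeration is the product of the
    -- units and can be cancelled; multiplying by `a` then contributes a factor exactly at the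
    -- non-zero elements.
    unit : Carrier → Carrier
    unit x with x ≟ 0#
    ... | yes _ = 1#
    ... | no  _ = x

    unit-≉0 : ∀ x → ¬ unit x ≈ 0#
    unit-≉0 x with x ≟ 0#
    ... | yes _   = 1≉0
    ... | no  x≉0 = x≉0

    unit-cong : ∀ {x y} → x ≈ y → unit x ≈ unit y
    unit-cong {x} {y} x≈y with x ≟ 0# | y ≟ 0#
    ... | yes _   | yes _   = refl
    ... | yes x≈0 | no y≉0  = contradiction (trans (sym x≈y) x≈0) y≉0
    ... | no x≉0  | yes y≈0 = contradiction (trans x≈y y≈0) x≉0
    ... | no _    | no _    = x≈y

    unit-* : ∀ x → unit (a * x) ≈ a ^ ⟦ nonzero? x ⟧ * unit x
    unit-* x with x ≟ 0# | (a * x) ≟ 0#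
    ... | yes _   | yes _    = sym (*-identityˡ _)
    ... | yes x≈0 | no ax≉0  = contradiction (trans (*-congˡ x≈0) (zeroʳ a)) ax≉0
    ... | no x≉0  | yes ax≈0 = contradiction (x*y≈0⇒y≈0 a≉0 ax≈0) x≉0
    ... | no _    | no _     = *-congʳ (sym (*-identityʳ a))

    P = ∏.sum (unit ∘ enum)

    opaque
      unfolding ∑
      ∏a^nonzero : ∏.sum (λ i → a ^ ⟦ nonzero? (enum i) ⟧) ≈ a ^ ∑ (λ x → ⟦ nonzero? x ⟧)
      ∏a^nonzero = ∏-^ a (λ i → ⟦ nonzero? (enum i) ⟧)

    a^units≈1 : a ^ ∑ (λ x → ⟦ nonzero? x ⟧) ≈ 1#
    a^units≈1 = *-cancelˡ-≉0 (∏-≉0 (unit ∘ enum) (unit-≉0 ∘ enum)) (begin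
      P * a ^ ∑ (λ x → ⟦ nonzero? x ⟧)
        ≈⟨ *-comm _ _ ⟩
      a ^ ∑ (λ x → ⟦ nonzero? x ⟧) * P
        ≈⟨ *-congʳ ∏a^nonzero ⟨
      ∏.sum (λ i → a ^ ⟦ nonzero? (enum i) ⟧) * P
        ≈⟨ ∏.∑-distrib-+ (λ i → a ^ ⟦ nonzero? (enum i) ⟧) (unit ∘ enum) ⟨
      ∏.sum (λ i → a ^ ⟦ nonzero? (enum i) ⟧ * unit (enum i))
        ≈⟨ ∏.sum-cong-≋ {size} (unit-* ∘ enum) ⟨
      ∏.sum (λ i → unit (a * enum i))
        ≈⟨ sum-reindex *-commutativeMonoid unit-cong *-congˡ *-congˡ
             (λ x → trans (sym (*-assoc _ _ _)) (trans (*-congʳ (inv-r a a≉0)) (*-identityˡ x)))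
             (λ x → trans (sym (*-assoc _ _ _)) (trans (*-congʳ (inv-l a a≉0)) (*-identityˡ x))) ⟨
      P
        ≈⟨ *-identityʳ P ⟨
      P * 1# ∎)

    size≡1+units : suc (∑ (λ x → ⟦ nonzero? x ⟧)) ≡ size
    size≡1+units = ≡.trans
      (≡.cong (ℕ._+ ∑ (λ x → ⟦ nonzero? x ⟧)) (≡.sym (∑-singleton (_≟ 0#) 0# id id)))
      (≡.trans (≡.sym (∑-+ (λ x → ⟦ x ≟ 0# ⟧) (λ x → ⟦ nonzero? x ⟧)))
      (≡.trans (∑-cong (λ x → ⟦⟧+⟦¬⟧ (x ≟ 0#))) (≡.trans (∑-const 1) (ℕ.*-identityʳ size))))

  -- Translation by 1 permutes the field, so the sum S of all elements equals S + `size` · 1; cancel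
  -- S.
  size×1≈0 : size · 1# ≈ 0#
  size×1≈0 = trans (sym (+-identityˡ _)) (trans (+-congʳ (sym (-‿inverseˡ S))) (trans (+-assoc _ _ _)
    (trans (+-congˡ (trans (+-congˡ (sym (ΣK.sum-replicate size))) (trans (sym (ΣK.∑-distrib-+ enum (λ _ → 1#)))
      (sym (sum-reindex +-commutativeMonoid id +-congʳ +-congʳ
        (solve 1 (λ x → (x :- con (+ 1)) :+ con (+ 1) := x) refl)
        (solve 1 (λ x → (x :+ con (+ 1)) :- con (+ 1) := x) refl)))))) (-‿inverseˡ S))))
    where
    module ΣK = Sum +-commutativeMonoid
    S = ΣK.sum enum

  -- A `FiniteField` carries only its cardinality. The characteristic is read off from (q · 1)^n =
  -- `size` · 1 = 0, as a field has no non-zero nilpotents.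
  characteristic : ∀ {q} n → size ≡ q ℕ.^ n → q · 1# ≈ 0#
  characteristic {q} n size≡q^n with (q · 1#) ≟ 0#
  ... | yes q≈0 = q≈0
  ... | no q≉0 = contradiction
    (trans (sym (^×1 n)) (trans (reflexive (≡.cong (_· 1#) (≡.sym size≡q^n))) size×1≈0)) (^-≉0 n q≉0)
    where
    ^×1 : ∀ n → (q ℕ.^ n) · 1# ≈ (q · 1#) ^ n
    ^×1 zero    = +-identityʳ 1#
    ^×1 (suc n) = trans (×1-homo-* q (q ℕ.^ n)) (*-congˡ (^×1 n))

  module Characteristic {q} (q-prime : Prime q) (q×1≈0 : q · 1# ≈ 0#) where

    q×x≈0 : ∀ x → q · x ≈ 0#
    q×x≈0 x = trans (×-congʳ q (sym (*-identityˡ x))) (trans (sym (×-assoc-* q 1# x))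
      (trans (*-congʳ q×1≈0) (zeroˡ x)))

    ∣×x≈0 : ∀ {n} x → q ∣ n → n · x ≈ 0#
    ∣×x≈0 x (divides k ≡.refl) = trans (sym (×-assocˡ x k q)) (trans (×-congʳ k (q×x≈0 x)) (k×0 k))
      where
      k×0 : ∀ k → k · 0# ≈ 0#
      k×0 zero    = refl
      k×0 (suc k) = trans (+-identityˡ _) (k×0 k)

    -- For q = 2h + 1, the equation 1 + 1 = 0 would reduce q · 1 = 0 to 1 = 0.
    2≉0 : ¬ 2 ∣ q → CharNot2
    2≉0 2∤q 1+1≈0 with odd-decomposition 2∤q
    ... | h , ≡.refl = 1≉0 (begin
      1#                     ≈⟨ +-identityʳ 1# ⟨
      1# + 0#                ≈⟨ +-congˡ (2h×1≈0 h) ⟨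
      1# + (h ℕ.* 2) · 1#    ≈⟨ q×1≈0 ⟩
      0#                     ∎)
      where
      2h×1≈0 : ∀ h → (h ℕ.* 2) · 1# ≈ 0#
      2h×1≈0 zero    = refl
      2h×1≈0 (suc h) = trans (+-congˡ (+-congˡ (2h×1≈0 h)))
        (trans (+-congˡ (+-identityʳ 1#)) 1+1≈0)

    open import Algebra.Properties.CommutativeSemiring.Binomial commutativeSemiring
      using (binomialTerm; theorem)

    frobenius-+ : AdditivePower q
    frobenius-+ x y = go q-prime ≡.refl
      where
      module ΣK = Sum +-commutativeMonoid
      -- The copy `m` of `q` can be matched as a successor, which splits the binomial sum into its
      -- first, middle and last terms.
      go : ∀ {m} → Prime m → m ≡ q → (x + y) ^ m ≈ x ^ m + y ^ m
      go {suc m} m-prime ≡.refl = begin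
        (x + y) ^ q
          ≈⟨ theorem q x y ⟩
        t zero + ΣK.sum (t ∘ suc)
          ≈⟨ +-cong t-first (ΣK.sum-init-last (t ∘ suc)) ⟩
        y ^ q + (ΣK.sum {m} (λ i → t (suc (Fin.inject₁ i))) + t (suc (Fin.fromℕ m)))
          ≈⟨ +-congˡ (+-cong (trans (ΣK.sum-cong-≋ {m} t-middle) (ΣK.sum-replicate-zero m)) t-last) ⟩
        y ^ q + (0# + x ^ q)
          ≈⟨ solve 2 (λ x y → y :+ (con (+ 0) :+ x) := x :+ y) refl (x ^ q) (y ^ q) ⟩
        x ^ q + y ^ q ∎
        where
        t = binomialTerm x y q
        t-first : t zero ≈ y ^ q
        t-first = trans (+-identityʳ _) (*-identityˡ _)
        t-last : t (suc (Fin.fromℕ m)) ≈ x ^ q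
        t-last rewrite Fin.toℕ-fromℕ m | nCn≡1 q | ℕ.n∸n≡0 m = trans (+-identityʳ _) (*-identityʳ _)
        t-middle : ∀ i → t (suc (Fin.inject₁ i)) ≈ 0#
        t-middle i rewrite Fin.toℕ-inject₁ i = ∣×x≈0 _ (prime∣C q-prime (Fin.toℕ i) (s≤s (Fin.toℕ<n i)))

-- Polynomial functions, root counting and exact fibre sizes.

module Polynomials {c ℓ} (K : FiniteField c ℓ) where
  open FiniteField K hiding (zero)
  open FieldSums K
  open IntegerSolver commRing
  open FieldArithmetic K
  open import Relation.Binary.Reasoning.Setoid setoid

  -- Poly a n f: the function f is given by a polynomial of degree at most n whose coefficient at x^n is a.
  data Poly (a : Carrier) : ℕ → (Carrier → Carrier) → Set (c ⊔ ℓ) where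
    const  : ∀ {f} → (∀ x → f x ≈ a) → Poly a 0 f
    horner : ∀ {n f g} b → Poly a n g → (∀ x → f x ≈ b + x * g x) → Poly a (suc n) f

  Poly-resp : ∀ {a n f g} → (∀ x → g x ≈ f x) → Poly a n f → Poly a n g
  Poly-resp g≈f (const f≈a)       = const λ x → trans (g≈f x) (f≈a x)
  Poly-resp g≈f (horner b P f≈bP) = horner b P λ x → trans (g≈f x) (f≈bP x)

  Poly-resp-lead : ∀ {a b n f} → a ≈ b → Poly a n f → Poly b n f
  Poly-resp-lead a≈b (const f≈a)       = const λ x → trans (f≈a x) a≈b
  Poly-resp-lead a≈b (horner d P f≈dP) = horner d (Poly-resp-lead a≈b P) f≈dP

  Poly-suc : ∀ {a n f} → Poly a n f → Poly 0# (suc n) f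
  Poly-suc {a} (const f≈a) = horner a (const λ _ → refl)
    λ x → trans (f≈a x) (solve 2 (λ a x → a := a :+ x :* con (+ 0)) refl a x)
  Poly-suc (horner b P f≈bP) = horner b (Poly-suc P) f≈bP

  Poly-< : ∀ {a m n f} → m < n → Poly a m f → Poly 0# n f
  Poly-< {m = m} {n = suc n} (s≤s m≤n) P with m ℕ.≟ n
  ... | yes ≡.refl = Poly-suc P
  ... | no m≢n     = Poly-suc (Poly-< (ℕ.≤∧≢⇒< m≤n m≢n) P)

  Poly-+ : ∀ {a b n f g} → Poly a n f → Poly b n g → Poly (a + b) n (λ x → f x + g x)
  Poly-+ (const f≈a) (const g≈b) = const λ x → +-cong (f≈a x) (g≈b x)
  Poly-+ (horner {g = f′} b P f≈) (horner {g = g′} d Q g≈) = horner (b + d) (Poly-+ P Q)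
    λ x → trans (+-cong (f≈ x) (g≈ x))
      (solve 5 (λ b d x f g → (b :+ x :* f) :+ (d :+ x :* g) := (b :+ d) :+ x :* (f :+ g)) refl b d x (f′ x) (g′ x))

  Poly-* : ∀ {a n f} k → Poly a n f → Poly (k * a) n (λ x → k * f x)
  Poly-* k (const f≈a) = const λ x → *-congˡ (f≈a x)
  Poly-* k (horner {g = f′} b P f≈) = horner (k * b) (Poly-* k P)
    λ x → trans (*-congˡ (f≈ x))
      (solve 4 (λ k b x f → k :* (b :+ x :* f) := k :* b :+ x :* (k :* f)) refl k b x (f′ x))

  Poly-^ : ∀ n → Poly 1# n (_^ n)
  Poly-^ zero    = const λ _ → refl
  Poly-^ (suc n) = horner 0# (Poly-^ n) λ x → sym (+-identityˡ _)

  Poly-+-< : ∀ {a b m n f g} → m < n → Poly a n f → Poly b m g → Poly a n (λ x → f x + g x)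
  Poly-+-< m<n P Q = Poly-resp-lead (+-identityʳ _) (Poly-+ P (Poly-< m<n Q))

  -- The common shape of x^p - x - b, of x^r - x - b and x^r + x, and of the polynomial whose
  -- non-roots are non-squares or 0-free witnesses in `∃-antifixed-square`.
  Poly-trinomial : ∀ {n} → 2 ≤ n → ∀ k b → Poly 1# n (λ x → x ^ n + (k * x + b))
  Poly-trinomial 2≤n k b = Poly-+-< 2≤n (Poly-^ _)
    (horner b (const λ _ → refl) λ x → trans (+-comm _ _) (+-congˡ (*-comm k x)))

  Poly-cong : ∀ {a n f} → Poly a n f → f Preserves _≈_ ⟶ _≈_
  Poly-cong (const f≈a) x≈y = trans (f≈a _) (sym (f≈a _))
  Poly-cong (horner b P f≈) x≈y = trans (f≈ _) (trans (+-congˡ (*-cong x≈y (Poly-cong P x≈y))) (sym (f≈ _)))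

  -- Synthetic division by x - r. The quotient keeps the leading coefficient, so the induction in
  -- `#roots≤degree` can continue.
  Poly-divide : ∀ {a n f} → Poly a (suc n) f → ∀ r → ∃ λ q → Poly a n q × (∀ x → f x ≈ f r + (x - r) * q x)
  Poly-divide (horner {g = g} b P@(const g≈a) f≈) r = g , P , λ x → begin
    _                                  ≈⟨ f≈ x ⟩
    b + x * g x                        ≈⟨ solve 4 (λ b x r g → b :+ x :* g := (b :+ r :* g) :+ (x :- r) :* g) refl b x r (g x) ⟩
    (b + r * g x) + (x - r) * g x      ≈⟨ +-congʳ (+-congˡ (*-congˡ (trans (g≈a x) (sym (g≈a r))))) ⟩
    (b + r * g r) + (x - r) * g x      ≈⟨ +-congʳ (f≈ r) ⟨
    _                                  ∎
  Poly-divide (horner {g = g} b P@(horner _ _ _) f≈) r with Poly-divide P r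
  ... | q , Q , g≈ = (λ x → g r + x * q x) , horner (g r) Q (λ _ → refl) , λ x → begin
    _
      ≈⟨ f≈ x ⟩
    b + x * g x
      ≈⟨ +-congˡ (*-congˡ (g≈ x)) ⟩
    b + x * (g r + (x - r) * q x)
      ≈⟨ solve 5 (λ b x r g q → b :+ x :* (g :+ (x :- r) :* q) := (b :+ r :* g) :+ (x :- r) :* (g :+ x :* q)) refl b x r (g r) (q x) ⟩
    (b + r * g r) + (x - r) * (g r + x * q x)
      ≈⟨ +-congʳ (f≈ r) ⟨
    _ ∎

  #roots≤degree : ∀ {a n f} → ¬ a ≈ 0# → Poly a n f → ∑ (λ x → ⟦ f x ≟ 0# ⟧) ≤ n
  #roots≤degree {f = f} a≉0 (const f≈a) = ℕ.≤-reflexive (≡.trans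
    (∑-cong λ x → ⟦⟧-no (f x ≟ 0#) λ fx≈0 → a≉0 (trans (sym (f≈a x)) fx≈0))
    (≡.trans (∑-const 0) (ℕ.*-zeroʳ size)))
  #roots≤degree {n = suc n} {f = f} a≉0 P@(horner _ _ _) with any-dec (λ x≈y fx≈0 → trans (Poly-cong P (sym x≈y)) fx≈0) (λ x → f x ≟ 0#)
  ... | no ∄root = ℕ.≤-trans (ℕ.≤-reflexive (≡.trans
    (∑-cong λ x → ⟦⟧-no (f x ≟ 0#) λ fx≈0 → ∄root (x , fx≈0))
    (≡.trans (∑-const 0) (ℕ.*-zeroʳ size)))) z≤n
  ... | yes (r , fr≈0) with Poly-divide P r
  ... | q , Q , f≈ = ℕ.≤-trans (∑-mono-≤ root-split) (ℕ.≤-trans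
    (ℕ.≤-reflexive (≡.trans (∑-+ _ _) (≡.cong (ℕ._+ _) (∑-singleton (_≟ r) r id id))))
    (s≤s (#roots≤degree a≉0 Q)))
    where
    root-split : ∀ x → ⟦ f x ≟ 0# ⟧ ≤ ⟦ x ≟ r ⟧ ℕ.+ ⟦ q x ≟ 0# ⟧
    root-split x with x ≟ r
    ... | yes _  = ℕ.≤-trans (⟦⟧≤1 (f x ≟ 0#)) (s≤s z≤n)
    ... | no x≉r = ⟦⟧-mono (f x ≟ 0#) (q x ≟ 0#) λ fx≈0 →
      x*y≈0⇒y≈0 (x≉r ∘ x-y≈0⇒x≈y) (trans (sym (+-identityˡ _))
        (trans (+-congʳ (sym fr≈0)) (trans (sym (f≈ x)) fx≈0)))

  -- The source of the existence results below: elements of non-zero trace, eigenvectors of the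
  -- Frobenius map, non-squares.
  non-root : ∀ {a n f} → ¬ a ≈ 0# → Poly a n f → n < size → ∃ λ x → ¬ f x ≈ 0#
  non-root {n = n} {f = f} a≉0 P n<size
    with any-dec (λ x≈y fx≉0 fy≈0 → fx≉0 (trans (Poly-cong P x≈y) fy≈0)) (λ x → ¬? (f x ≟ 0#))
  ... | yes found = found
  ... | no ∄ = contradiction (ℕ.≤-trans (ℕ.≤-reflexive size≡#roots) (#roots≤degree a≉0 P)) (ℕ.<⇒≱ n<size)
    where
    size≡#roots : size ≡ ∑ (λ x → ⟦ f x ≟ 0# ⟧)
    size≡#roots = ≡.sym (≡.trans
      (∑-cong λ x → ⟦⟧-yes (f x ≟ 0#) (decidable-stable (f x ≟ 0#) λ fx≉0 → ∄ (x , fx≉0)))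
      (≡.trans (∑-const 1) (ℕ.*-identityʳ size)))

  ∑-fibres : ∀ {φ f} → f Preserves _≈_ ⟶ _≡_ → ∑ (λ b → ∑ (λ x → ⟦ φ x ≟ b ⟧) ℕ.* f b) ≡ ∑ (f ∘ φ)
  ∑-fibres {φ} {f} f-cong = ≡.trans
    (∑-cong λ b → ≡.trans (ℕ.*-comm (∑ (λ x → ⟦ φ x ≟ b ⟧)) (f b)) (≡.sym (∑-*ˡ (f b) _)))
    (≡.trans (∑-swap λ b x → f b ℕ.* ⟦ φ x ≟ b ⟧)
    (∑-cong λ x → ≡.trans
      (∑-supported {λ b → f b ℕ.* ⟦ φ x ≟ b ⟧}
        (λ b≈b′ → ≡.cong₂ ℕ._*_ (f-cong b≈b′) (⟦⟧-cong (_ ≟ _) (_ ≟ _) (λ e → trans e b≈b′) (λ e → trans e (sym b≈b′))))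
        (φ x) λ b b≉φx → ≡.trans (≡.cong (f b ℕ.*_) (⟦⟧-no (φ x ≟ b) (b≉φx ∘ sym))) (ℕ.*-zeroʳ (f b)))
      (≡.trans (≡.cong (f (φ x) ℕ.*_) (⟦⟧-yes (φ x ≟ φ x) refl)) (ℕ.*-identityʳ _))))

  -- Counting takes the place of linear algebra. A fibre of φ has at most m points and is empty
  -- outside the kernel of ψ, which has at most n points; since the fibres exhaust m n elements, all
  -- these bounds are equalities. For (x^p - x, T) this is additive Hilbert 90; for (x^r - x, x^r +
  -- x) it counts the elements of F_r.
  module Exactness {φ ψ : Carrier → Carrier} {m n : ℕ}
    (φ-cong : φ Preserves _≈_ ⟶ _≈_)
    (φ-fibre : ∀ b → Poly 1# m (λ x → φ x - b)) (ψ-poly : Poly 1# n ψ)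
    (ψφ≈0 : ∀ x → ψ (φ x) ≈ 0#) (size≡m*n : size ≡ m ℕ.* n) where

    #fibre : Carrier → ℕ
    #fibre b = ∑ (λ x → ⟦ φ x ≟ b ⟧)

    ψ-cong = Poly-cong ψ-poly

    #fibre-≤ : ∀ b → #fibre b ≤ m ℕ.* ⟦ ψ b ≟ 0# ⟧
    #fibre-≤ b with ψ b ≟ 0#
    ... | yes _ = ℕ.≤-trans
      (∑-mono-≤ λ x → ⟦⟧-mono (φ x ≟ b) ((φ x - b) ≟ 0#) x≈y⇒x-y≈0)
      (ℕ.≤-trans (#roots≤degree 1≉0 (φ-fibre b)) (ℕ.≤-reflexive (≡.sym (ℕ.*-identityʳ m))))
    ... | no ψb≉0 = ℕ.≤-trans
      (ℕ.≤-reflexive (≡.trans (∑-cong λ x → ⟦⟧-no (φ x ≟ b) λ φx≈b → ψb≉0 (trans (ψ-cong (sym φx≈b)) (ψφ≈0 x)))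
        (≡.trans (∑-const 0) (ℕ.*-zeroʳ size)))) z≤n

    ∑#fibre≡size : ∑ #fibre ≡ size
    ∑#fibre≡size = ≡.trans (∑-cong λ b → ≡.sym (ℕ.*-identityʳ (#fibre b)))
      (≡.trans (∑-fibres {φ} {λ _ → 1} λ _ → ≡.refl) (≡.trans (∑-const 1) (ℕ.*-identityʳ size)))

    #kernel : ℕ
    #kernel = ∑ (λ b → ⟦ ψ b ≟ 0# ⟧)

    size≤m*#kernel : size ≤ m ℕ.* #kernel
    size≤m*#kernel = ℕ.≤-trans (ℕ.≤-reflexive (≡.sym ∑#fibre≡size))
      (ℕ.≤-trans (∑-mono-≤ #fibre-≤) (ℕ.≤-reflexive (∑-*ˡ m _)))

    m*#kernel≡size : m ℕ.* #kernel ≡ size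
    m*#kernel≡size = ℕ.≤-antisym
      (ℕ.≤-trans (ℕ.*-monoʳ-≤ m (#roots≤degree 1≉0 ψ-poly)) (ℕ.≤-reflexive (≡.sym size≡m*n)))
      size≤m*#kernel

    #fibre≡ : ∀ b → #fibre b ≡ m ℕ.* ⟦ ψ b ≟ 0# ⟧
    #fibre≡ = ∑-mono-≤-≡
      (λ b≈b′ → ∑-cong λ x → ⟦⟧-cong (φ x ≟ _) (φ x ≟ _) (λ e → trans e b≈b′) (λ e → trans e (sym b≈b′)))
      (λ b≈b′ → ≡.cong (m ℕ.*_) (⟦⟧-cong (ψ _ ≟ 0#) (ψ _ ≟ 0#) (trans (ψ-cong (sym b≈b′))) (trans (ψ-cong b≈b′))))
      #fibre-≤
      (ℕ.≤-reflexive (≡.trans (∑-*ˡ m _) (≡.trans m*#kernel≡size (≡.sym ∑#fibre≡size))))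

-- The Frobenius map, twisted traces and the trace to F_p.

module Frobenius {c ℓ} (K : FiniteField c ℓ)
  (p : ℕ) (2≤p : 2 ≤ p) (^p-+ : FieldArithmetic.AdditivePower K p) where
  open FiniteField K hiding (zero)
  open FieldArithmetic K
  open FieldSums K
  open IntegerSolver commRing
  open Polynomials K
  open import Relation.Binary.Reasoning.Setoid setoid

  -- The subfield F_p inside K. The module is also instantiated at `p₀`, to iterate additivity, and
  -- at r = √|K|, where the fixed elements form F_r.
  Fixed : Carrier → Set ℓ
  Fixed t = t ^ p ≈ t

  Fixed-resp : ∀ {x y} → x ≈ y → Fixed x → Fixed y
  Fixed-resp x≈y x-fixed = trans (^-congˡ p (sym x≈y)) (trans x-fixed x≈y)

  0^p≈0 : Fixed 0#
  0^p≈0 = 0^n≈0 p {{ℕ.>-nonZero (ℕ.≤-trans (s≤s z≤n) 2≤p)}}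

  Fixed-+ : ∀ {s t} → Fixed s → Fixed t → Fixed (s + t)
  Fixed-+ s-fixed t-fixed = trans (^p-+ _ _) (+-cong s-fixed t-fixed)

  Fixed-* : ∀ {s t} → Fixed s → Fixed t → Fixed (s * t)
  Fixed-* s-fixed t-fixed = trans (^-distrib-* _ _ p) (*-cong s-fixed t-fixed)

  ^p-neg : ∀ x → (- x) ^ p ≈ - (x ^ p)
  ^p-neg x = x+y≈0⇒x≈-y (trans (sym (^p-+ _ _)) (trans (^-congˡ p (-‿inverseˡ x)) 0^p≈0))

  Fixed-neg : ∀ {t} → Fixed t → Fixed (- t)
  Fixed-neg t-fixed = trans (^p-neg _) (-‿cong t-fixed)

  Fixed-inv : ∀ {t} → ¬ t ≈ 0# → Fixed t → Fixed (inv t)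
  Fixed-inv = inv-^-fixed p

  ^p^suc : ∀ x n → x ^ (p ℕ.^ suc n) ≈ (x ^ p) ^ (p ℕ.^ n)
  ^p^suc x n = sym (^-assocʳ x p (p ℕ.^ n))

  ^p^suc′ : ∀ x n → x ^ (p ℕ.^ suc n) ≈ (x ^ (p ℕ.^ n)) ^ p
  ^p^suc′ x n = trans (^-congʳ x (ℕ.*-comm p (p ℕ.^ n))) (sym (^-assocʳ x (p ℕ.^ n) p))

  ^p^+ : ∀ x m n → x ^ (p ℕ.^ (m ℕ.+ n)) ≈ (x ^ (p ℕ.^ n)) ^ (p ℕ.^ m)
  ^p^+ x m n = trans (^-congʳ x (≡.trans (≡.cong (p ℕ.^_) (ℕ.+-comm m n)) (ℕ.^-distribˡ-+-* p n m)))
    (sym (^-assocʳ x (p ℕ.^ n) (p ℕ.^ m)))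

  ^p^n-+ : ∀ n → AdditivePower (p ℕ.^ n)
  ^p^n-+ zero x y = trans (*-identityʳ _) (sym (+-cong (*-identityʳ x) (*-identityʳ y)))
  ^p^n-+ (suc n) x y = begin
    (x + y) ^ (p ℕ.^ suc n)                      ≈⟨ ^p^suc _ n ⟩
    ((x + y) ^ p) ^ (p ℕ.^ n)                    ≈⟨ ^-congˡ (p ℕ.^ n) (^p-+ x y) ⟩
    (x ^ p + y ^ p) ^ (p ℕ.^ n)                  ≈⟨ ^p^n-+ n _ _ ⟩
    (x ^ p) ^ (p ℕ.^ n) + (y ^ p) ^ (p ℕ.^ n)    ≈⟨ +-cong (^p^suc x n) (^p^suc y n) ⟨
    x ^ (p ℕ.^ suc n) + y ^ (p ℕ.^ suc n)        ∎

  Fixed-^p^n : ∀ n {t} → Fixed t → t ^ (p ℕ.^ n) ≈ t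
  Fixed-^p^n zero    t-fixed = *-identityʳ _
  Fixed-^p^n (suc n) t-fixed = trans (^p^suc _ n) (trans (^-congˡ (p ℕ.^ n) t-fixed) (Fixed-^p^n n t-fixed))

  eigen-^p^n : ∀ n {γ x} → Fixed γ → x ^ p ≈ γ * x → x ^ (p ℕ.^ n) ≈ γ ^ n * x
  eigen-^p^n zero    γ-fixed eq = *-comm _ _
  eigen-^p^n (suc n) {γ} {x} γ-fixed eq = begin
    x ^ (p ℕ.^ suc n)                    ≈⟨ ^p^suc x n ⟩
    (x ^ p) ^ (p ℕ.^ n)                  ≈⟨ ^-congˡ (p ℕ.^ n) eq ⟩
    (γ * x) ^ (p ℕ.^ n)                  ≈⟨ ^-distrib-* γ x (p ℕ.^ n) ⟩
    γ ^ (p ℕ.^ n) * x ^ (p ℕ.^ n)        ≈⟨ *-cong (Fixed-^p^n n γ-fixed) (eigen-^p^n n γ-fixed eq) ⟩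
    γ * (γ ^ n * x)                      ≈⟨ *-assoc _ _ _ ⟨
    γ ^ suc n * x                        ∎

  -- The twisted trace x ↦ Σ_{i<n} α^(n-1-i) x^(p^i); it is the usual trace for α = 1.
  tr : Carrier → ℕ → Carrier → Carrier
  tr α zero    x = 0#
  tr α (suc n) x = x ^ (p ℕ.^ n) + α * tr α n x

  tr-cong : ∀ α n {x y} → x ≈ y → tr α n x ≈ tr α n y
  tr-cong α zero    x≈y = refl
  tr-cong α (suc n) x≈y = +-cong (^-congˡ (p ℕ.^ n) x≈y) (*-congˡ (tr-cong α n x≈y))

  -- A telescoping sum: all terms but the two extreme ones cancel. When α^n = 1 and x^(p^n) = x the
  -- right side vanishes, so the twisted trace is an eigenvector for α.
  tr-frobenius : ∀ {α} → Fixed α → ∀ n x → tr α n x ^ p - α * tr α n x ≈ x ^ (p ℕ.^ n) - α ^ n * x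
  tr-frobenius {α} α-fixed zero x = begin
    0# ^ p - α * 0#          ≈⟨ +-congʳ 0^p≈0 ⟩
    0# - α * 0#              ≈⟨ solve 2 (λ α x → con (+ 0) :- α :* con (+ 0) := x :* con (+ 1) :- con (+ 1) :* x) refl α x ⟩
    x * 1# - 1# * x          ∎
  tr-frobenius {α} α-fixed (suc n) x = begin
    (xₙ + α * t) ^ p - α * (xₙ + α * t)
      ≈⟨ +-congʳ (trans (^p-+ _ _) (+-cong (sym (^p^suc′ x n)) (trans (^-distrib-* α t p) (*-congʳ α-fixed)))) ⟩
    (xₙ₊₁ + α * t ^ p) - α * (xₙ + α * t)
      ≈⟨ solve 5 (λ xₙ xₙ₊₁ α t tp → (xₙ₊₁ :+ α :* tp) :- α :* (xₙ :+ α :* t)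
                    := xₙ₊₁ :+ α :* (tp :- α :* t) :- α :* xₙ) refl xₙ xₙ₊₁ α t (t ^ p) ⟩
    xₙ₊₁ + α * (t ^ p - α * t) - α * xₙ
      ≈⟨ +-congʳ (+-congˡ (*-congˡ (tr-frobenius α-fixed n x))) ⟩
    xₙ₊₁ + α * (xₙ - α ^ n * x) - α * xₙ
      ≈⟨ solve 5 (λ xₙ xₙ₊₁ α αₙ x → xₙ₊₁ :+ α :* (xₙ :- αₙ :* x) :- α :* xₙ
                    := xₙ₊₁ :- (α :* αₙ) :* x) refl xₙ xₙ₊₁ α (α ^ n) x ⟩
    xₙ₊₁ - α ^ suc n * x ∎
    where
    t = tr α n x
    xₙ = x ^ (p ℕ.^ n)
    xₙ₊₁ = x ^ (p ℕ.^ suc n)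

  tr-+ : ∀ α n x y → tr α n (x + y) ≈ tr α n x + tr α n y
  tr-+ α zero    x y = sym (+-identityˡ 0#)
  tr-+ α (suc n) x y = trans (+-cong (^p^n-+ n x y) (*-congˡ (tr-+ α n x y)))
    (solve 5 (λ x y α s t → (x :+ y) :+ α :* (s :+ t) := (x :+ α :* s) :+ (y :+ α :* t)) refl
      (x ^ (p ℕ.^ n)) (y ^ (p ℕ.^ n)) α (tr α n x) (tr α n y))

  tr-* : ∀ α n {t} → Fixed t → ∀ x → tr α n (t * x) ≈ t * tr α n x
  tr-* α zero    {t} t-fixed x = sym (zeroʳ t)
  tr-* α (suc n) {t} t-fixed x = trans
    (+-cong (trans (^-distrib-* t x (p ℕ.^ n)) (*-congʳ (Fixed-^p^n n t-fixed))) (*-congˡ (tr-* α n t-fixed x)))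
    (solve 4 (λ t x α s → t :* x :+ α :* (t :* s) := t :* (x :+ α :* s)) refl t (x ^ (p ℕ.^ n)) α (tr α n x))

  tr₁-frobenius : ∀ n x → tr 1# n (x ^ p) ≈ tr 1# n x ^ p
  tr₁-frobenius zero    x = sym 0^p≈0
  tr₁-frobenius (suc n) x = begin
    (x ^ p) ^ (p ℕ.^ n) + 1# * tr 1# n (x ^ p)    ≈⟨ +-cong (trans (sym (^p^suc x n)) (^p^suc′ x n)) (trans (*-identityˡ _) (tr₁-frobenius n x)) ⟩
    (x ^ (p ℕ.^ n)) ^ p + tr 1# n x ^ p           ≈⟨ ^p-+ _ _ ⟨
    (x ^ (p ℕ.^ n) + tr 1# n x) ^ p               ≈⟨ ^-congˡ p (+-congˡ (*-identityˡ _)) ⟨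
    (x ^ (p ℕ.^ n) + 1# * tr 1# n x) ^ p          ∎

  -- The sum over the exponents is cut at n. Cut in the middle, it yields transitivity of the trace
  -- through F_r; iterated, it yields traces of elements of a subfield.
  tr₁-+-index : ∀ m n x → tr 1# (m ℕ.+ n) x ≈ tr 1# m (x ^ (p ℕ.^ n)) + tr 1# n x
  tr₁-+-index zero    n x = sym (+-identityˡ _)
  tr₁-+-index (suc m) n x = begin
    x ^ (p ℕ.^ (m ℕ.+ n)) + 1# * tr 1# (m ℕ.+ n) x
      ≈⟨ +-cong (^p^+ x m n) (*-congˡ (tr₁-+-index m n x)) ⟩
    y ^ (p ℕ.^ m) + 1# * (tr 1# m y + tr 1# n x)
      ≈⟨ solve 3 (λ y s t → y :+ con (+ 1) :* (s :+ t) := (y :+ con (+ 1) :* s) :+ t) refl (y ^ (p ℕ.^ m)) (tr 1# m y) (tr 1# n x) ⟩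
    (y ^ (p ℕ.^ m) + 1# * tr 1# m y) + tr 1# n x ∎
    where y = x ^ (p ℕ.^ n)

  ^p^*-fixed : ∀ m {x} → x ^ (p ℕ.^ m) ≈ x → ∀ k → x ^ (p ℕ.^ (k ℕ.* m)) ≈ x
  ^p^*-fixed m eq zero    = *-identityʳ _
  ^p^*-fixed m eq (suc k) = trans (^p^+ _ m (k ℕ.* m)) (trans (^-congˡ (p ℕ.^ m) (^p^*-fixed m eq k)) eq)

  tr₁-subfield : ∀ m {x} → x ^ (p ℕ.^ m) ≈ x → ∀ k → tr 1# (k ℕ.* m) x ≈ k · tr 1# m x
  tr₁-subfield m eq zero    = refl
  tr₁-subfield m {x} eq (suc k) = trans (tr₁-+-index m (k ℕ.* m) x)
    (+-cong (tr-cong 1# m (^p^*-fixed m eq k)) (tr₁-subfield m eq k))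

  p^n<p^[1+n] : ∀ n → p ℕ.^ n < p ℕ.^ suc n
  p^n<p^[1+n] n = ℕ.^-monoʳ-< p 2≤p (ℕ.n<1+n n)

  tr-poly : ∀ α n → Poly 1# (p ℕ.^ n) (tr α (suc n))
  tr-poly α zero = horner 0# (const λ _ → refl)
    λ x → solve 2 (λ α x → x :* con (+ 1) :+ α :* con (+ 0) := con (+ 0) :+ x :* con (+ 1)) refl α x
  tr-poly α (suc n) = Poly-+-< (p^n<p^[1+n] n) (Poly-^ _) (Poly-* α (tr-poly α n))

  module Trace (N : ℕ) (size≡ : size ≡ p ℕ.^ suc N) where

    x^p^[1+N]≈x : ∀ x → x ^ (p ℕ.^ suc N) ≈ x
    x^p^[1+N]≈x x = trans (^-congʳ x (≡.sym size≡)) (x^size≈x x)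

    -- The degree p^N is less than `size` = p^(N + 1); hence the exponent is presented as `suc N`.
    tr-nonzero : ∀ α → ∃ λ x → ¬ tr α (suc N) x ≈ 0#
    tr-nonzero α = non-root 1≉0 (tr-poly α N) (≡.subst (p ℕ.^ N <_) (≡.sym size≡) (p^n<p^[1+n] N))

    -- Multiplicative Hilbert 90: for α in F_p the norm from K is α^(N + 1), and a non-zero value of
    -- the twisted trace is the required element.
    eigenvector : ∀ {α} → Fixed α → α ^ suc N ≈ 1# → ∃ λ ξ → ¬ ξ ≈ 0# × ξ ^ p ≈ α * ξ
    eigenvector {α} α-fixed αⁿ≈1
      with x , tr≉0 ← tr-nonzero α
      = tr α (suc N) x , tr≉0 , x-y≈0⇒x≈y (trans (tr-frobenius α-fixed (suc N) x)
          (x≈y⇒x-y≈0 (trans (x^p^[1+N]≈x x) (sym (trans (*-congʳ αⁿ≈1) (*-identityˡ x))))))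

    T : Carrier → Carrier
    T = tr 1# (suc N)

    T-cong : T Preserves _≈_ ⟶ _≈_
    T-cong = tr-cong 1# (suc N)

    T-+ : ∀ x y → T (x + y) ≈ T x + T y
    T-+ = tr-+ 1# (suc N)

    T-* : ∀ {t} → Fixed t → ∀ x → T (t * x) ≈ t * T x
    T-* = tr-* 1# (suc N)

    T-0 : T 0# ≈ 0#
    T-0 = trans (T-cong (sym (zeroˡ 0#))) (trans (T-* 0^p≈0 0#) (zeroˡ _))

    T-fixed : ∀ x → Fixed (T x)
    T-fixed x = x-y≈0⇒x≈y (begin
      T x ^ p - T x                              ≈⟨ +-congˡ (-‿cong (*-identityˡ _)) ⟨
      T x ^ p - 1# * T x                         ≈⟨ tr-frobenius (1^n≈1 p) (suc N) x ⟩
      x ^ (p ℕ.^ suc N) - 1# ^ suc N * x         ≈⟨ x≈y⇒x-y≈0 (trans (x^p^[1+N]≈x x) (sym (trans (*-congʳ (1^n≈1 (suc N))) (*-identityˡ x)))) ⟩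
      0#                                         ∎)

    T-℘≈0 : ∀ x → T (x ^ p - x) ≈ 0#
    T-℘≈0 x = begin
      T (x ^ p - x)                   ≈⟨ solve 2 (λ s t → s := (s :+ t) :- t) refl (T (x ^ p - x)) (T x) ⟩
      (T (x ^ p - x) + T x) - T x     ≈⟨ +-congʳ (T-+ _ _) ⟨
      T ((x ^ p - x) + x) - T x       ≈⟨ +-congʳ (T-cong (solve 2 (λ y x → (y :- x) :+ x := y) refl (x ^ p) x)) ⟩
      T (x ^ p) - T x                 ≈⟨ +-congʳ (tr₁-frobenius (suc N) x) ⟩
      T x ^ p - T x                   ≈⟨ x≈y⇒x-y≈0 (T-fixed x) ⟩
      0#                              ∎

    ℘-cong : (λ x → x ^ p - x) Preserves _≈_ ⟶ _≈_
    ℘-cong x≈y = +-cong (^-congˡ p x≈y) (-‿cong x≈y)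

    module ℘ = Exactness {λ x → x ^ p - x} {T} ℘-cong
      (λ b → Poly-resp (λ x → solve 3 (λ y x b → (y :- x) :- b := y :+ (:- con (+ 1) :* x :+ :- b)) refl (x ^ p) x b)
        (Poly-trinomial 2≤p (- 1#) (- b)))
      (tr-poly 1# N) T-℘≈0 size≡

    Fixed? : ∀ t → Dec (Fixed t)
    Fixed? t = (t ^ p) ≟ t

    #Fixed≡p : ∑ (λ t → ⟦ Fixed? t ⟧) ≡ p
    #Fixed≡p = ≡.trans
      (∑-cong λ t → ⟦⟧-cong (Fixed? t) ((t ^ p - t) ≟ 0#) x≈y⇒x-y≈0 x-y≈0⇒x≈y)
      (≡.trans (℘.#fibre≡ 0#) (≡.trans (≡.cong (p ℕ.*_) (⟦⟧-yes (T 0# ≟ 0#) T-0)) (ℕ.*-identityʳ p)))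

    -- The scalars are the Frobenius-fixed elements, which keeps F_p inside K; membership is
    -- decidable so that it can enter sums as an indicator.
    record Subspace g : Set (c ⊔ ℓ ⊔ Level.suc g) where
      field
        _∈G     : Carrier → Set g
        _∈G?    : ∀ a → Dec (a ∈G)
        ∈G-resp : ∀ {a b} → a ≈ b → a ∈G → b ∈G
        ∈G-+    : ∀ {a b} → a ∈G → b ∈G → (a + b) ∈G
        ∈G-*    : ∀ {t a} → Fixed t → a ∈G → (t * a) ∈G
        0∈G     : 0# ∈G

      ∣G∣ : ℕ
      ∣G∣ = ∑ (λ a → ⟦ a ∈G? ⟧)

      ∈G-neg : ∀ {a} → a ∈G → (- a) ∈G
      ∈G-neg a∈G = ∈G-resp (solve 1 (λ a → :- con (+ 1) :* a := :- a) refl _) (∈G-* (Fixed-neg (1^n≈1 p)) a∈G)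

      ∈G-translate : ∀ {b} → b ∈G → ∀ a → ⟦ (a + b) ∈G? ⟧ ≡ ⟦ a ∈G? ⟧
      ∈G-translate b∈G a = ⟦⟧-cong (_ ∈G?) (_ ∈G?)
        (λ a+b∈G → ∈G-resp (solve 2 (λ a b → (a :+ b) :+ :- b := a) refl _ _) (∈G-+ a+b∈G (∈G-neg b∈G)))
        (λ a∈G → ∈G-+ a∈G b∈G)

      -- A function that is affine and non-constant along the lines parallel to F_p a₀ has one zero on each of them.
      equidistribution : ∀ {h a₀ e} → h Preserves _≈_ ⟶ _≈_ → (∀ a → Fixed (h a)) →
        a₀ ∈G → Fixed e → ¬ e ≈ 0# →
        (∀ {t} → Fixed t → ∀ a → h (a + t * a₀) ≈ h a + t * e) →
        p ℕ.* ∑ (λ a → ⟦ a ∈G? ⟧ ℕ.* ⟦ h a ≟ 0# ⟧) ≡ ∣G∣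
      equidistribution {h} {a₀} {e} h-cong h-fixed a₀∈G e-fixed e≉0 h-affine = ≡.trans
        -- Count the pairs of t in F_p and a in G with h a + t e = 0. Each t contributes S, by the
        -- translation a ↦ a + t a₀ of G; each a contributes one pair, with t = - h a / e.
        (≡.cong (ℕ._* S) (≡.sym #Fixed≡p))
        (≡.trans (ℕ.*-comm _ S)
        (≡.trans (≡.sym (∑-*ˡ S _))
        (≡.trans (∑-cong along)
        (≡.trans (∑-swap λ t a → ⟦ a ∈G? ⟧ ℕ.* ⟦ Fixed? t ×-dec ((h a + t * e) ≟ 0#) ⟧)
        (∑-cong λ a → ≡.trans (∑-*ˡ ⟦ a ∈G? ⟧ _)
          (≡.trans (≡.cong (⟦ a ∈G? ⟧ ℕ.*_) (one-zero a)) (ℕ.*-identityʳ _)))))))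
        where
        S = ∑ (λ a → ⟦ a ∈G? ⟧ ℕ.* ⟦ h a ≟ 0# ⟧)

        shift : ∀ {t} → Fixed t → S ≡ ∑ (λ a → ⟦ a ∈G? ⟧ ℕ.* ⟦ (h a + t * e) ≟ 0# ⟧)
        shift {t} t-fixed = ≡.trans
          (∑-reindex {λ a → ⟦ a ∈G? ⟧ ℕ.* ⟦ h a ≟ 0# ⟧}
            (λ a≈b → ≡.cong₂ ℕ._*_ (⟦⟧-cong (_ ∈G?) (_ ∈G?) (∈G-resp a≈b) (∈G-resp (sym a≈b)))
              (⟦⟧-cong (h _ ≟ 0#) (h _ ≟ 0#) (trans (h-cong (sym a≈b))) (trans (h-cong a≈b))))
            {_+ t * a₀} {_- t * a₀} +-congʳ +-congʳ
            (λ a → solve 2 (λ a b → (a :- b) :+ b := a) refl a _)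
            (λ a → solve 2 (λ a b → (a :+ b) :- b := a) refl a _))
          (∑-cong λ a → ≡.cong₂ ℕ._*_ (∈G-translate (∈G-* t-fixed a₀∈G) a)
            (⟦⟧-cong (h (a + t * a₀) ≟ 0#) ((h a + t * e) ≟ 0#)
              (trans (sym (h-affine t-fixed a))) (trans (h-affine t-fixed a))))

        along : ∀ t → S ℕ.* ⟦ Fixed? t ⟧ ≡ ∑ (λ a → ⟦ a ∈G? ⟧ ℕ.* ⟦ Fixed? t ×-dec ((h a + t * e) ≟ 0#) ⟧)
        along t = go (Fixed? t)
          where
          go : (t? : Dec (Fixed t)) → S ℕ.* ⟦ t? ⟧ ≡ ∑ (λ a → ⟦ a ∈G? ⟧ ℕ.* ⟦ t? ×-dec ((h a + t * e) ≟ 0#) ⟧)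
          go (yes t-fixed) = ≡.trans (ℕ.*-identityʳ S) (≡.trans (shift t-fixed)
            (∑-cong λ a → ≡.cong (⟦ a ∈G? ⟧ ℕ.*_) (⟦⟧-cong ((h a + t * e) ≟ 0#) (yes t-fixed ×-dec ((h a + t * e) ≟ 0#)) (t-fixed ,_) proj₂)))
          go (no ¬t-fixed) = ≡.trans (ℕ.*-zeroʳ S) (≡.sym (≡.trans
            (∑-cong λ a → ≡.trans (≡.cong (⟦ a ∈G? ⟧ ℕ.*_) (⟦⟧-no (no ¬t-fixed ×-dec ((h a + t * e) ≟ 0#)) (¬t-fixed ∘ proj₁))) (ℕ.*-zeroʳ ⟦ a ∈G? ⟧))
            (≡.trans (∑-const 0) (ℕ.*-zeroʳ size))))

        one-zero : ∀ a → ∑ (λ t → ⟦ Fixed? t ×-dec ((h a + t * e) ≟ 0#) ⟧) ≡ 1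
        one-zero a = ∑-singleton (λ t → Fixed? t ×-dec ((h a + t * e) ≟ 0#)) (- h a * inv e)
          (λ (_ , zero-at-t) → *-cancelˡ-≉0 e≉0 (trans (x≈-ha zero-at-t) (sym root)))
          (λ t≈ → Fixed-resp (sym t≈) (Fixed-* (Fixed-neg (h-fixed a)) (Fixed-inv e≉0 e-fixed)) ,
             trans (+-congˡ (trans (*-comm _ _) (trans (*-congˡ t≈) root))) (-‿inverseʳ _))
          where
          root : e * (- h a * inv e) ≈ - h a
          root = begin
            e * (- h a * inv e)   ≈⟨ solve 3 (λ e h i → e :* (h :* i) := (e :* i) :* h) refl e (- h a) (inv e) ⟩
            (e * inv e) * - h a   ≈⟨ *-congʳ (inv-r e e≉0) ⟩
            1# * - h a            ≈⟨ *-identityˡ _ ⟩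
            - h a                 ∎
          x≈-ha : ∀ {t} → h a + t * e ≈ 0# → e * t ≈ - h a
          x≈-ha eq = trans (*-comm _ _) (x+y≈0⇒x≈-y (trans (+-comm _ _) eq))

    -- Zeros of the quadratic form T (b v²).

    module QuadraticForm (b : Carrier) where

      Q : Carrier → Carrier
      Q v = T (b * (v * v))

      B : Carrier → Carrier → Carrier
      B v a = T ((1# + 1#) * b * v * a)

      Q-cong : Q Preserves _≈_ ⟶ _≈_
      Q-cong x≈y = T-cong (*-congˡ (*-cong x≈y x≈y))

      Q-+ : ∀ v a → Q (v + a) ≈ Q v + B v a + Q a
      Q-+ v a = begin
        Q (v + a)
          ≈⟨ T-cong (solve 3 (λ b v a → b :* ((v :+ a) :* (v :+ a)) := (b :* (v :* v) :+ con (+ 2) :* b :* v :* a) :+ b :* (a :* a)) refl b v a) ⟩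
        T ((b * (v * v) + (1# + 1#) * b * v * a) + b * (a * a))
          ≈⟨ T-+ _ _ ⟩
        T (b * (v * v) + (1# + 1#) * b * v * a) + Q a
          ≈⟨ +-congʳ (T-+ _ _) ⟩
        Q v + B v a + Q a ∎

      #zeros : ℕ
      #zeros = ∑ (λ v → ⟦ Q v ≟ 0# ⟧)

      -- Average Q v = 0 over the translates v + G of an isotropic subspace G with orthogonal complement P;
      -- both sides are arranged so that no subtraction occurs.
      #zeros-via-isotropic : ∀ {g} (G : Subspace g) → let open Subspace G in
        (∀ {a} → a ∈G → Q a ≈ 0#) →
        ∀ {ℓ′} {P : Carrier → Set ℓ′} (P? : ∀ v → Dec (P v)) →
        (∀ {v a} → P v → a ∈G → B v a ≈ 0#) →
        (∀ {v} → ¬ P v → ∃ λ a → a ∈G × ¬ B v a ≈ 0#) →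
        p ℕ.* #zeros ℕ.+ ∑ (λ v → ⟦ P? v ⟧) ≡ size ℕ.+ p ℕ.* ∑ (λ v → ⟦ P? v ⟧ ℕ.* ⟦ Q v ≟ 0# ⟧)
      #zeros-via-isotropic G Q≈0 {P = P} P? P⊥G ¬P⇒ = ℕ.*-cancelˡ-≡ _ _ ∣G∣ {{∣G∣≢0}} total
        where
        open Subspace G

        ∣G∣≢0 : ℕ.NonZero ∣G∣
        ∣G∣≢0 = ℕ.>-nonZero (ℕ.≤-trans (ℕ.≤-reflexive (≡.sym (∑-singleton (_≟ 0#) 0# id id)))
          (∑-mono-≤ λ a → ⟦⟧-mono (a ≟ 0#) (a ∈G?) λ a≈0 → ∈G-resp (sym a≈0) 0∈G))

        -- As Q vanishes on G, this is the number of a in G with Q (v + a) = 0.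
        S : Carrier → ℕ
        S v = ∑ (λ a → ⟦ a ∈G? ⟧ ℕ.* ⟦ (Q v + B v a) ≟ 0# ⟧)

        Z PQ #P : ℕ
        Z = #zeros
        PQ = ∑ (λ v → ⟦ P? v ⟧ ℕ.* ⟦ Q v ≟ 0# ⟧)
        #P = ∑ (λ v → ⟦ P? v ⟧)

        translate : ∀ a → #zeros ≡ ∑ (λ v → ⟦ Q (v + a) ≟ 0# ⟧)
        translate a = ∑-reindex {λ v → ⟦ Q v ≟ 0# ⟧}
          (λ x≈y → ⟦⟧-cong (Q _ ≟ 0#) (Q _ ≟ 0#) (trans (Q-cong (sym x≈y))) (trans (Q-cong x≈y)))
          {_+ a} {_- a} +-congʳ +-congʳ
          (λ v → solve 2 (λ v a → (v :- a) :+ a := v) refl v a)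
          (λ v → solve 2 (λ v a → (v :+ a) :- a := v) refl v a)

        on-G : ∀ a v → ⟦ a ∈G? ⟧ ℕ.* ⟦ Q (v + a) ≟ 0# ⟧ ≡ ⟦ a ∈G? ⟧ ℕ.* ⟦ (Q v + B v a) ≟ 0# ⟧
        on-G a v with a ∈G?
        ... | no _ = ≡.refl
        ... | yes a∈G = ≡.cong (1 ℕ.*_) (⟦⟧-cong (Q (v + a) ≟ 0#) ((Q v + B v a) ≟ 0#) (trans (sym eq)) (trans eq))
          where
          eq : Q (v + a) ≈ Q v + B v a
          eq = trans (Q-+ v a) (trans (+-congˡ (Q≈0 a∈G)) (+-identityʳ _))

        ∑S : ∑ S ≡ ∣G∣ ℕ.* Z
        ∑S = ≡.trans (∑-swap λ v a → ⟦ a ∈G? ⟧ ℕ.* ⟦ (Q v + B v a) ≟ 0# ⟧)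
          (≡.trans (∑-cong λ a → ≡.trans (∑-cong λ v → ≡.sym (on-G a v))
            (≡.trans (∑-*ˡ ⟦ a ∈G? ⟧ _) (≡.trans (≡.cong (⟦ a ∈G? ⟧ ℕ.*_) (≡.sym (translate a))) (ℕ.*-comm _ Z))))
          (≡.trans (∑-*ˡ Z _) (ℕ.*-comm Z _)))

        -- Off P the function a ↦ Q v + B v a is affine and non-constant on G, so |G| / p of its
        -- values are zero; on P it is the constant Q v, so all or none are. The indicator of P
        -- merges both into one formula.
        pS : ∀ v → p ℕ.* S v ℕ.+ ∣G∣ ℕ.* ⟦ P? v ⟧ ≡ ∣G∣ ℕ.+ ∣G∣ ℕ.* p ℕ.* (⟦ P? v ⟧ ℕ.* ⟦ Q v ≟ 0# ⟧)
        pS v with P? v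
        ... | no ¬Pv with a₀ , a₀∈G , Bva₀≉0 ← ¬P⇒ ¬Pv = ≡.cong₂ ℕ._+_
          (equidistribution {λ a → Q v + B v a} {a₀} {B v a₀}
            (λ a≈b → +-congˡ (T-cong (*-congˡ a≈b)))
            (λ a → Fixed-+ (T-fixed _) (T-fixed _))
            a₀∈G (T-fixed _) Bva₀≉0
            λ {t} t-fixed a → trans (+-congˡ (trans
              (T-cong (solve 4 (λ m a t a₀ → m :* (a :+ t :* a₀) := m :* a :+ t :* (m :* a₀)) refl ((1# + 1#) * b * v) a t a₀))
              (trans (T-+ _ _) (+-congˡ (T-* t-fixed _))))) (sym (+-assoc _ _ _)))
          (≡.trans (ℕ.*-zeroʳ ∣G∣) (≡.sym (ℕ.*-zeroʳ (∣G∣ ℕ.* p))))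
        ... | yes Pv = ≡.trans (≡.cong (λ s → p ℕ.* s ℕ.+ ∣G∣ ℕ.* 1) (≡.trans
            (∑-cong λ a → ≡.trans (constant a) (ℕ.*-comm ⟦ a ∈G? ⟧ ⟦ Q v ≟ 0# ⟧))
            (∑-*ˡ ⟦ Q v ≟ 0# ⟧ _)))
          (arrange p ⟦ Q v ≟ 0# ⟧ ∣G∣)
          where
          arrange : ∀ p q g → p ℕ.* (q ℕ.* g) ℕ.+ g ℕ.* 1 ≡ g ℕ.+ g ℕ.* p ℕ.* (1 ℕ.* q)
          arrange = solve-∀
          constant : ∀ a → ⟦ a ∈G? ⟧ ℕ.* ⟦ (Q v + B v a) ≟ 0# ⟧ ≡ ⟦ a ∈G? ⟧ ℕ.* ⟦ Q v ≟ 0# ⟧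
          constant a with a ∈G?
          ... | no _ = ≡.refl
          ... | yes a∈G = ≡.cong (1 ℕ.*_) (⟦⟧-cong ((Q v + B v a) ≟ 0#) (Q v ≟ 0#) (trans (sym eq)) (trans eq))
            where
            eq : Q v + B v a ≈ Q v
            eq = trans (+-congˡ (P⊥G Pv a∈G)) (+-identityʳ _)

        total : ∣G∣ ℕ.* (p ℕ.* Z ℕ.+ #P) ≡ ∣G∣ ℕ.* (size ℕ.+ p ℕ.* PQ)
        total = ≡.trans (left ∣G∣ p Z #P) (≡.trans
          (≡.cong₂ ℕ._+_ (≡.trans (≡.cong (p ℕ.*_) (≡.sym ∑S)) (≡.sym (∑-*ˡ p S))) (≡.sym (∑-*ˡ ∣G∣ _)))
          (≡.trans (≡.sym (∑-+ _ _)) (≡.trans (∑-cong pS) (≡.trans (∑-+ _ _)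
          (≡.trans (≡.cong₂ ℕ._+_ (∑-const ∣G∣) (∑-*ˡ (∣G∣ ℕ.* p) _)) (right ∣G∣ p size PQ))))))
          where
          left : ∀ g p z n → g ℕ.* (p ℕ.* z ℕ.+ n) ≡ p ℕ.* (g ℕ.* z) ℕ.+ g ℕ.* n
          left = solve-∀
          right : ∀ g p s n → s ℕ.* g ℕ.+ g ℕ.* p ℕ.* n ≡ g ℕ.* (s ℕ.+ p ℕ.* n)
          right = solve-∀

-- The point count over a field of r² elements.

module Curve {c ℓ} (K : FiniteField c ℓ)
  (p : ℕ) (2≤p : 2 ≤ p) (^p-+ : FieldArithmetic.AdditivePower K p) (1+1≉0 : FieldArithmetic.CharNot2 K)
  (s′ : ℕ) (size≡ : FiniteField.size K ≡ p ℕ.^ (suc s′ ℕ.+ suc s′)) where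
  open FiniteField K hiding (zero)
  open FieldArithmetic K
  open FieldSums K
  open IntegerSolver commRing
  open Polynomials K
  open Frobenius K p 2≤p ^p-+
  open Trace (s′ ℕ.+ suc s′) size≡
  open import Relation.Binary.Reasoning.Setoid setoid

  -- As s is a successor, `s + s` computes to the form `suc N` that `Trace` expects.
  s r : ℕ
  s = suc s′
  r = p ℕ.^ s

  2≤r : 2 ≤ r
  2≤r = ℕ.≤-trans 2≤p (ℕ.≤-trans (ℕ.≤-reflexive (≡.sym (ℕ.*-identityʳ p)))
    (ℕ.*-monoʳ-≤ p (ℕ.m^n>0 p {{ℕ.>-nonZero (ℕ.≤-trans (s≤s z≤n) 2≤p)}} s′)))

  size≡r*r : size ≡ r ℕ.* r
  size≡r*r = ≡.trans size≡ (ℕ.^-distribˡ-+-* p s s)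

  module R = Frobenius K r 2≤r (^p^n-+ s)

  Fixed⇒R-Fixed : ∀ {t} → Fixed t → R.Fixed t
  Fixed⇒R-Fixed = Fixed-^p^n s

  2-fixed : Fixed (1# + 1#)
  2-fixed = Fixed-+ (1^n≈1 p) (1^n≈1 p)

  x^r^r≈x : ∀ x → (x ^ r) ^ r ≈ x
  x^r^r≈x x = trans (sym (^p^+ x s s)) (x^p^[1+N]≈x x)

  x^r+x-fixed : ∀ x → R.Fixed (x ^ r + x)
  x^r+x-fixed x = trans (^p^n-+ s _ _) (trans (+-congʳ (x^r^r≈x x)) (+-comm _ _))

  -- Transitivity of the trace: x^r + x is the trace of x from K to F_r, and the outer sum is the
  -- trace from F_r to F_p.
  T-halves : ∀ x → T x ≈ tr 1# s (x ^ r + x)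
  T-halves x = trans (tr₁-+-index s s x) (sym (tr-+ 1# s _ _))

  T-anti≈0 : ∀ {x} → x ^ r ≈ - x → T x ≈ 0#
  T-anti≈0 {x} xʳ≈-x = trans (T-halves x) (trans
    (tr-cong 1# s (trans (+-congʳ xʳ≈-x) (trans (-‿inverseˡ x) (sym (zeroˡ 0#)))))
    (trans (tr-* 1# s 0^p≈0 0#) (zeroˡ _)))

  R-fixed? : ∀ a → Dec (R.Fixed a)
  R-fixed? a = (a ^ r) ≟ a

  module Half = Exactness {λ x → x ^ r - x} {λ x → x ^ r + x}
    (λ x≈y → +-cong (^-congˡ r x≈y) (-‿cong x≈y))
    (λ b → Poly-resp (λ x → solve 3 (λ y x b → (y :- x) :- b := y :+ (:- con (+ 1) :* x :+ :- b)) refl (x ^ r) x b)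
        (Poly-trinomial 2≤r (- 1#) (- b)))
    (Poly-resp (λ x → solve 2 (λ y x → y :+ x := y :+ (con (+ 1) :* x :+ con (+ 0))) refl (x ^ r) x)
      (Poly-trinomial 2≤r 1# 0#))
    (λ x → begin
      (x ^ r - x) ^ r + (x ^ r - x)              ≈⟨ +-congʳ (trans (^p^n-+ s _ _) (+-cong (x^r^r≈x x) (R.^p-neg x))) ⟩
      (x - x ^ r) + (x ^ r - x)                  ≈⟨ solve 2 (λ x y → (x :- y) :+ (y :- x) := con (+ 0)) refl x (x ^ r) ⟩
      0#                                         ∎)
    size≡r*r

  #R-fixed≡r : ∑ (λ a → ⟦ R-fixed? a ⟧) ≡ r
  #R-fixed≡r = ≡.trans
    (∑-cong λ t → ⟦⟧-cong (R-fixed? t) ((t ^ r - t) ≟ 0#) x≈y⇒x-y≈0 x-y≈0⇒x≈y)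
    (≡.trans (Half.#fibre≡ 0#) (≡.trans
      (≡.cong (r ℕ.*_) (⟦⟧-yes ((0# ^ r + 0#) ≟ 0#) (trans (+-identityʳ _) R.0^p≈0))) (ℕ.*-identityʳ r)))

  fixedSubfield : Subspace ℓ
  fixedSubfield = record
    { _∈G = R.Fixed ; _∈G? = R-fixed? ; ∈G-resp = R.Fixed-resp ; ∈G-+ = R.Fixed-+
    ; ∈G-* = λ t-fixed → R.Fixed-* (Fixed⇒R-Fixed t-fixed) ; 0∈G = R.0^p≈0 }

  -- For b ≠ 0 this is the line F_p b⁻¹; membership in the form `b * a` in F_p is decidable and
  -- exhibits the scalar.
  multiplesOfInverse : Carrier → Subspace ℓ
  multiplesOfInverse b = record
    { _∈G = λ a → Fixed (b * a)
    ; _∈G? = λ a → Fixed? (b * a)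
    ; ∈G-resp = λ x≈y → Fixed-resp (*-congˡ x≈y)
    ; ∈G-+ = λ x∈ y∈ → Fixed-resp (sym (distribˡ _ _ _)) (Fixed-+ x∈ y∈)
    ; ∈G-* = λ t-fixed x∈ → Fixed-resp (solve 3 (λ b t a → t :* (b :* a) := b :* (t :* a)) refl _ _ _) (Fixed-* t-fixed x∈)
    ; 0∈G = Fixed-resp (sym (zeroʳ b)) 0^p≈0 }

  open QuadraticForm

  #isotropicTraceZero : Carrier → ℕ
  #isotropicTraceZero b = ∑ (λ v → ⟦ T v ≟ 0# ⟧ ℕ.* ⟦ Q b v ≟ 0# ⟧)

  -- The averaging formula for the line F_p b⁻¹: Q (t b⁻¹) = t² T (b⁻¹) = 0, and B (v, b⁻¹) = 2 T v
  -- identifies the complement with the kernel of T.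
  #zeros-hyperplane : ∀ {b} → ¬ b ≈ 0# → T (inv b) ≈ 0# →
    p ℕ.* #zeros b ℕ.+ ℘.#kernel ≡ size ℕ.+ p ℕ.* #isotropicTraceZero b
  #zeros-hyperplane {b} b≉0 Tb⁻¹≈0 = #zeros-via-isotropic b (multiplesOfInverse b)
    (λ {a} ba-fixed → begin
      T (b * (a * a))                    ≈⟨ T-cong (*-identityʳ _) ⟨
      T (b * (a * a) * 1#)               ≈⟨ T-cong (*-congˡ (inv-r b b≉0)) ⟨
      T (b * (a * a) * (b * inv b))      ≈⟨ T-cong (solve 3 (λ b a i → b :* (a :* a) :* (b :* i) := (b :* a) :* (b :* a) :* i) refl b a (inv b)) ⟩
      T ((b * a) * (b * a) * inv b)      ≈⟨ T-* (Fixed-* ba-fixed ba-fixed) (inv b) ⟩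
      (b * a) * (b * a) * T (inv b)      ≈⟨ *-congˡ Tb⁻¹≈0 ⟩
      (b * a) * (b * a) * 0#             ≈⟨ zeroʳ _ ⟩
      0#                                 ∎)
    (λ v → T v ≟ 0#)
    (λ {v} {a} Tv≈0 ba-fixed → begin
      T ((1# + 1#) * b * v * a)          ≈⟨ T-cong (solve 3 (λ b v a → con (+ 2) :* b :* v :* a := (con (+ 2) :* (b :* a)) :* v) refl b v a) ⟩
      T ((1# + 1#) * (b * a) * v)        ≈⟨ T-* (Fixed-* 2-fixed ba-fixed) v ⟩
      (1# + 1#) * (b * a) * T v          ≈⟨ *-congˡ Tv≈0 ⟩
      (1# + 1#) * (b * a) * 0#           ≈⟨ zeroʳ _ ⟩
      0#                                 ∎)
    (λ {v} Tv≉0 → inv b , Fixed-resp (sym (inv-r b b≉0)) (1^n≈1 p) , λ B≈0 → *-≉0 1+1≉0 Tv≉0 (begin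
      (1# + 1#) * T v                    ≈⟨ T-* 2-fixed v ⟨
      T ((1# + 1#) * v)                  ≈⟨ T-cong (*-identityʳ _) ⟨
      T ((1# + 1#) * v * 1#)             ≈⟨ T-cong (*-congˡ (inv-r b b≉0)) ⟨
      T ((1# + 1#) * v * (b * inv b))    ≈⟨ T-cong (solve 3 (λ b v a → con (+ 2) :* v :* (b :* a) := con (+ 2) :* b :* v :* a) refl b v (inv b)) ⟩
      T ((1# + 1#) * b * v * inv b)      ≈⟨ B≈0 ⟩
      0#                                 ∎))

  -- The averaging formula with G = P = F_r. On F_r the form is identically zero, so the last sum of
  -- the formula is r as well.
  #zeros-anti : ∀ {b} → ¬ b ≈ 0# → b ^ r ≈ - b → p ℕ.* #zeros b ℕ.+ r ≡ size ℕ.+ p ℕ.* r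
  #zeros-anti {b} b≉0 bʳ≈-b = ≡.trans
    (≡.cong (p ℕ.* #zeros b ℕ.+_) (≡.sym #R-fixed≡r))
    (≡.trans (#zeros-via-isotropic b fixedSubfield
      isotropic R-fixed? (λ {v} {a} v-fixed a-fixed → T-anti≈0 (trans (^-distrib-* _ a r) (trans
        (*-cong (trans (w^r v) (trans (*-congˡ v-fixed) (solve 2 (λ b v → con (+ 2) :* :- b :* v := :- (con (+ 2) :* b :* v)) refl b v))) a-fixed)
        (-‿*ˡ _ _))))
      non-perp)
    (≡.cong (λ n → size ℕ.+ p ℕ.* n) (≡.trans (∑-cong isotropic-count) #R-fixed≡r)))
    where
    -‿*ˡ : ∀ x y → - x * y ≈ - (x * y)
    -‿*ˡ x y = sym (-‿distribˡ-* x y)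

    isotropic : ∀ {a} → R.Fixed a → Q b a ≈ 0#
    isotropic {a} a-fixed = T-anti≈0 (trans (^-distrib-* b (a * a) r)
      (trans (*-cong bʳ≈-b (R.Fixed-* a-fixed a-fixed)) (-‿*ˡ _ _)))

    isotropic-count : ∀ v → ⟦ R-fixed? v ⟧ ℕ.* ⟦ Q b v ≟ 0# ⟧ ≡ ⟦ R-fixed? v ⟧
    isotropic-count v with R-fixed? v
    ... | no _ = ≡.refl
    ... | yes v-fixed = ≡.trans (ℕ.*-identityˡ _) (⟦⟧-yes (Q b v ≟ 0#) (isotropic v-fixed))

    w^r : ∀ v → ((1# + 1#) * b * v) ^ r ≈ (1# + 1#) * - b * v ^ r
    w^r v = trans (^-distrib-* _ v r) (*-congʳ (trans (^-distrib-* _ b r) (*-cong (Fixed⇒R-Fixed 2-fixed) bʳ≈-b)))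

    non-perp : ∀ {v} → ¬ R.Fixed v → ∃ λ a → R.Fixed a × ¬ B b v a ≈ 0#
    non-perp {v} ¬v-fixed = a , a-fixed , λ Bva≈0 → Tx≉0 (begin
      T x                          ≈⟨ T-halves x ⟩
      tr 1# s (x ^ r + x)          ≈⟨ tr-cong 1# s e*a ⟨
      tr 1# s (e * a)              ≈⟨ tr-cong 1# s (distribʳ a _ _) ⟩
      tr 1# s (w ^ r * a + w * a)  ≈⟨ tr-cong 1# s (+-congʳ (trans (^-distrib-* w a r) (*-congˡ a-fixed))) ⟨
      tr 1# s ((w * a) ^ r + w * a)  ≈⟨ T-halves (w * a) ⟨
      T (w * a)                    ≈⟨ Bva≈0 ⟩
      0#                           ∎)
      where
      x = proj₁ (tr-nonzero 1#)
      Tx≉0 = proj₂ (tr-nonzero 1#)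
      w = (1# + 1#) * b * v
      e = w ^ r + w
      e≉0 : ¬ e ≈ 0#
      e≉0 e≈0 = ¬v-fixed (sym (x-y≈0⇒x≈y (x*y≈0⇒y≈0 (*-≉0 1+1≉0 b≉0) (begin
        (1# + 1#) * b * (v - v ^ r)                    ≈⟨ solve 3 (λ b v u → con (+ 2) :* b :* (v :- u) := con (+ 2) :* :- b :* u :+ con (+ 2) :* b :* v) refl b v (v ^ r) ⟩
        (1# + 1#) * - b * v ^ r + w                    ≈⟨ +-congʳ (w^r v) ⟨
        e                                              ≈⟨ e≈0 ⟩
        0#                                             ∎))))
      -- For w = 2bv the relative trace e = w^r + w equals 2b (v - v^r), which is non-zero off F_r.
      -- This choice makes e a the relative trace of x, whence B v a = T (w a) = T x ≠ 0.
      a = (x ^ r + x) * inv e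
      a-fixed : R.Fixed a
      a-fixed = R.Fixed-* (x^r+x-fixed x) (R.Fixed-inv e≉0 (x^r+x-fixed w))
      e*a : e * a ≈ x ^ r + x
      e*a = begin
        e * ((x ^ r + x) * inv e)    ≈⟨ solve 3 (λ e y i → e :* (y :* i) := (e :* i) :* y) refl e (x ^ r + x) (inv e) ⟩
        (e * inv e) * (x ^ r + x)    ≈⟨ *-congʳ (inv-r e e≉0) ⟩
        1# * (x ^ r + x)             ≈⟨ *-identityˡ _ ⟩
        x ^ r + x                    ∎

  ∑-scale : ∀ {f} → f Preserves _≈_ ⟶ _≡_ → ∀ {k} → ¬ k ≈ 0# → ∑ f ≡ ∑ (λ x → f (k * x))
  ∑-scale {f} f-cong {k} k≉0 = ∑-reindex {f} f-cong {k *_} {inv k *_} *-congˡ *-congˡ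
    (λ x → trans (sym (*-assoc _ _ _)) (trans (*-congʳ (inv-r k k≉0)) (*-identityˡ x)))
    (λ x → trans (sym (*-assoc _ _ _)) (trans (*-congʳ (inv-l k k≉0)) (*-identityˡ x)))

  -- Only the class of b modulo non-zero squares matters, since v ↦ k v permutes K.
  #zeros-scale : ∀ b {k} → ¬ k ≈ 0# → #zeros b ≡ #zeros (b * (k * k))
  #zeros-scale b {k} k≉0 = ≡.trans
    (∑-scale {λ v → ⟦ Q b v ≟ 0# ⟧}
      (λ x≈y → ⟦⟧-cong (Q b _ ≟ 0#) (Q b _ ≟ 0#) (trans (Q-cong b (sym x≈y))) (trans (Q-cong b x≈y))) k≉0)
    (∑-cong λ v → ⟦⟧-cong (Q b (k * v) ≟ 0#) (Q (b * (k * k)) v ≟ 0#)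
      (trans (T-cong (sym (eq v)))) (trans (T-cong (eq v))))
    where
    eq : ∀ v → b * ((k * v) * (k * v)) ≈ b * (k * k) * (v * v)
    eq = solve 3 (λ b k v → b :* ((k :* v) :* (k :* v)) := b :* (k :* k) :* (v :* v)) refl b k

  module _ {α β ξ ζ : Carrier} (α-fixed : Fixed α) (α≉0 : ¬ α ≈ 0#) (β-relation : β * (α * (α + 1#)) ≈ - 1#)
           (ξ≉0 : ¬ ξ ≈ 0#) (ξᵖ≈αξ : ξ ^ p ≈ α * ξ) (ζᵖ≈βζ : ζ ^ p ≈ β * ζ) where

    private
      b : Carrier
      b = ζ * (ξ * ξ)

    -- With U = u^p and b^p = βα² b one has ζ ξu R(ξu) = − α b (U − u)² + (w^p − w) for w = − (α + 1) b u².
    T-curve : ∀ u → T (ζ * ((ξ * u) * Rpoly K p (ξ * u))) ≈ - α * Q b (u ^ p - u)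
    T-curve u = begin
      T (ζ * ((ξ * u) * ((1# + 1#) * pow K (ξ * u) p + ξ * u)))
        ≈⟨ T-cong (*-congˡ (*-congˡ (+-congʳ (*-congˡ (trans (reflexive (pow≡^ (ξ * u) p))
             (trans (^-distrib-* ξ u p) (*-congʳ ξᵖ≈αξ))))))) ⟩
      T (ζ * ((ξ * u) * ((1# + 1#) * (α * ξ * U) + ξ * u)))
        ≈⟨ T-cong (solve 5 (λ ζ ξ u α U →
             ζ :* ((ξ :* u) :* (con (+ 2) :* (α :* ξ :* U) :+ ξ :* u))
               := :- α :* (ζ :* (ξ :* ξ) :* ((U :- u) :* (U :- u)))
                  :+ (α :* (ζ :* (ξ :* ξ)) :* (U :* U) :- :- (α :+ con (+ 1)) :* (ζ :* (ξ :* ξ)) :* (u :* u)))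
             refl ζ ξ u α U) ⟩
      T (- α * (b * ((U - u) * (U - u))) + (α * b * (U * U) - w))
        ≈⟨ T-cong (+-congˡ (+-congʳ wᵖ)) ⟨
      T (- α * (b * ((U - u) * (U - u))) + (w ^ p - w))
        ≈⟨ T-+ _ _ ⟩
      T (- α * (b * ((U - u) * (U - u)))) + T (w ^ p - w)
        ≈⟨ +-cong (T-* (Fixed-neg α-fixed) _) (T-℘≈0 w) ⟩
      - α * Q b (U - u) + 0#
        ≈⟨ +-identityʳ _ ⟩
      - α * Q b (U - u) ∎
      where
      U = u ^ p
      w = - (α + 1#) * b * (u * u)
      wᵖ : w ^ p ≈ α * b * (U * U)
      wᵖ = begin
        w ^ p
          ≈⟨ trans (^-distrib-* _ (u * u) p) (*-cong (^-distrib-* _ b p) (^-distrib-* u u p)) ⟩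
        (- (α + 1#)) ^ p * b ^ p * (U * U)
          ≈⟨ *-congʳ (*-cong (Fixed-neg (Fixed-+ α-fixed (1^n≈1 p)))
               (trans (^-distrib-* ζ _ p) (*-cong ζᵖ≈βζ (trans (^-distrib-* ξ ξ p) (*-cong ξᵖ≈αξ ξᵖ≈αξ))))) ⟩
        - (α + 1#) * (β * ζ * (α * ξ * (α * ξ))) * (U * U)
          ≈⟨ solve 5 (λ α β ζ ξ U → :- (α :+ con (+ 1)) :* (β :* ζ :* (α :* ξ :* (α :* ξ))) :* (U :* U)
                := :- (β :* (α :* (α :+ con (+ 1)))) :* (α :* (ζ :* (ξ :* ξ)) :* (U :* U))) refl α β ζ ξ U ⟩
        - (β * (α * (α + 1#))) * (α * b * (U * U))
          ≈⟨ *-congʳ (trans (-‿cong β-relation) (-‿involutive 1#)) ⟩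
        1# * (α * b * (U * U))
          ≈⟨ *-identityˡ _ ⟩
        α * b * (U * U) ∎

    -- One factor p is the number of y above an admissible x = ξ u; the other is the number of u
    -- with u^p - u = v, for each v of trace zero.
    affineCount≡p²A : affineCount K p ζ ≡ p ℕ.* (p ℕ.* #isotropicTraceZero b)
    affineCount≡p²A = ≡.trans (affineCount≡∑ K p ζ)
      (≡.trans (∑-cong λ x → ≡.trans
        (∑-cong λ y → ⟦⟧-cong ((pow K y p - y) ≟ curve x) ((y ^ p - y) ≟ curve x)
          (trans (+-congʳ (reflexive (≡.sym (pow≡^ y p))))) (trans (+-congʳ (reflexive (pow≡^ y p)))))
        (℘.#fibre≡ (curve x)))
      (≡.trans (∑-*ˡ p _)
      (≡.cong (p ℕ.*_) (≡.trans
        (∑-scale {λ x → ⟦ T (curve x) ≟ 0# ⟧}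
          (λ x≈y → ⟦⟧-cong (T (curve _) ≟ 0#) (T (curve _) ≟ 0#) (trans (T-cong (curve-cong (sym x≈y)))) (trans (T-cong (curve-cong x≈y)))) ξ≉0)
        (≡.trans (∑-cong λ u → ⟦⟧-cong (T (curve (ξ * u)) ≟ 0#) (Q b (u ^ p - u) ≟ 0#)
          (λ T≈0 → x*y≈0⇒y≈0 -α≉0 (trans (sym (T-curve u)) T≈0))
          (λ Q≈0 → trans (T-curve u) (trans (*-congˡ Q≈0) (zeroʳ _))))
        (≡.trans (≡.sym (∑-fibres {λ u → u ^ p - u} {λ v → ⟦ Q b v ≟ 0# ⟧}
          λ x≈y → ⟦⟧-cong (Q b _ ≟ 0#) (Q b _ ≟ 0#) (trans (Q-cong b (sym x≈y))) (trans (Q-cong b x≈y))))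
        (≡.trans (∑-cong λ v → ≡.trans (≡.cong (ℕ._* ⟦ Q b v ≟ 0# ⟧) (℘.#fibre≡ v)) (ℕ.*-assoc p _ _))
        (∑-*ˡ p _))))))))
      where
      curve : Carrier → Carrier
      curve x = ζ * (x * Rpoly K p x)
      curve-cong : ∀ {x y} → x ≈ y → curve x ≈ curve y
      curve-cong {x} {y} x≈y = *-congˡ (*-cong x≈y (+-cong (*-congˡ
        (trans (reflexive (pow≡^ x p)) (trans (^-congˡ p x≈y) (reflexive (≡.sym (pow≡^ y p)))))) x≈y))
      -α≉0 : ¬ - α ≈ 0#
      -α≉0 -α≈0 = α≉0 (trans (sym (-‿involutive α)) (trans (-‿cong -α≈0) -0#≈0#))

    -- Eliminating Z, the number of zeros on K, from `hyperplane` and `hyperbolic` leaves p A + r =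
    -- p r + κ with p κ = `size`. Multiplied by p this reads p² A = `size` + p (p - 1) r, and p (p -
    -- 1) is twice the genus.
    maximal : ¬ ζ ≈ 0# → T (inv b) ≈ 0# →
              (∃ λ k → ¬ k ≈ 0# × (b * (k * k)) ^ r ≈ - (b * (k * k))) →
              (∃ λ h → p ≡ suc (h ℕ.* 2)) → Maximal K p ζ r
    maximal ζ≉0 Tb⁻¹≈0 (k , k≉0 , anti) (h , p≡) =
      ≡.trans (≡.cong (ℕ._+ 1) (≡.trans affineCount≡p²A p²A))
      (≡.trans (≡.cong (λ n → size ℕ.+ n ℕ.* r ℕ.+ 1) (≡.sym 2*genus)) (rearrange size (2 ℕ.* genus K p ℕ.* r)))
      where
      b≉0 : ¬ b ≈ 0#
      b≉0 = *-≉0 ζ≉0 (*-≉0 ξ≉0 ξ≉0)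
      A Z κ : ℕ
      A = #isotropicTraceZero b
      Z = #zeros b
      κ = ℘.#kernel

      hyperplane : p ℕ.* Z ℕ.+ κ ≡ size ℕ.+ p ℕ.* A
      hyperplane = #zeros-hyperplane b≉0 Tb⁻¹≈0

      hyperbolic : p ℕ.* Z ℕ.+ r ≡ size ℕ.+ p ℕ.* r
      hyperbolic = ≡.trans (≡.cong (λ z → p ℕ.* z ℕ.+ r) (#zeros-scale b k≉0)) (#zeros-anti (*-≉0 b≉0 (*-≉0 k≉0 k≉0)) anti)

      pA+r : p ℕ.* A ℕ.+ r ≡ p ℕ.* r ℕ.+ κ
      pA+r = ℕ.+-cancelˡ-≡ size _ _ (≡.trans (≡.sym (ℕ.+-assoc size _ r)) (≡.trans (≡.cong (ℕ._+ r) (≡.sym hyperplane))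
        (≡.trans (swap (p ℕ.* Z) κ r) (≡.trans (≡.cong (ℕ._+ κ) hyperbolic) (ℕ.+-assoc size _ κ)))))
        where
        swap : ∀ x y z → x ℕ.+ y ℕ.+ z ≡ x ℕ.+ z ℕ.+ y
        swap = solve-∀

      -- The division in `genus` rounds down; it is exact because p - 1 = 2h.
      2*genus : 2 ℕ.* genus K p ≡ p ℕ.* (h ℕ.* 2)
      2*genus = ≡.trans (≡.cong (λ n → 2 ℕ.* ((p ℕ.* n) ℕ./ 2)) (≡.cong ℕ.pred p≡))
        (≡.trans (≡.cong (λ n → 2 ℕ.* (n ℕ./ 2)) (≡.sym (ℕ.*-assoc p h 2)))
        (≡.trans (≡.cong (2 ℕ.*_) (ℕ.m*n/n≡m (p ℕ.* h) 2)) (rearrange p h)))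
        where
        rearrange : ∀ p h → 2 ℕ.* (p ℕ.* h) ≡ p ℕ.* (h ℕ.* 2)
        rearrange = solve-∀

      p²A : p ℕ.* (p ℕ.* A) ≡ size ℕ.+ p ℕ.* (h ℕ.* 2) ℕ.* r
      p²A = ℕ.+-cancelʳ-≡ (p ℕ.* r) _ _ (≡.trans (≡.sym (ℕ.*-distribˡ-+ p (p ℕ.* A) r))
        (≡.trans (≡.cong (p ℕ.*_) pA+r) (≡.trans (ℕ.*-distribˡ-+ p (p ℕ.* r) κ)
        (≡.trans (≡.cong (p ℕ.* (p ℕ.* r) ℕ.+_) ℘.m*#kernel≡size)
        (≡.trans (≡.cong (λ q → p ℕ.* (q ℕ.* r) ℕ.+ size) p≡) (rearrange p h r size))))))
        where
        rearrange : ∀ p h r S → p ℕ.* (suc (h ℕ.* 2) ℕ.* r) ℕ.+ S ≡ S ℕ.+ p ℕ.* (h ℕ.* 2) ℕ.* r ℕ.+ p ℕ.* r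
        rearrange = solve-∀

      rearrange : ∀ S x → S ℕ.+ x ℕ.+ 1 ≡ S ℕ.+ 1 ℕ.+ x
      rearrange = solve-∀

-- Residues modulo 2 and 4.

odd-* : ∀ a b → suc (a ℕ.* 2) ℕ.* suc (b ℕ.* 2) ≡ suc ((a ℕ.+ b ℕ.+ 2 ℕ.* a ℕ.* b) ℕ.* 2)
odd-* = solve-∀

odd-^ : ∀ h n → ∃ λ h′ → suc (h ℕ.* 2) ℕ.^ n ≡ suc (h′ ℕ.* 2)
odd-^ h zero = 0 , ≡.refl
odd-^ h (suc n) with h′ , eq ← odd-^ h n = h ℕ.+ h′ ℕ.+ 2 ℕ.* h ℕ.* h′ , ≡.trans (≡.cong (suc (h ℕ.* 2) ℕ.*_) eq) (odd-* h h′)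

-- Odd squares are 1 modulo 4, so each further factor n² keeps the residue 3. The witness is read
-- off from (3 + 4q)² (3 + 4j).
%4≡3⇒^odd : ∀ {n} → n ℕ.% 4 ≡ 3 → ∀ h → ∃ λ j → n ℕ.^ suc (h ℕ.* 2) ≡ 3 ℕ.+ j ℕ.* 4
%4≡3⇒^odd {n} n%4≡3 zero = n ℕ./ 4 , ≡.trans (ℕ.*-identityʳ n)
  (≡.trans (ℕ.m≡m%n+[m/n]*n n 4) (≡.cong (ℕ._+ n ℕ./ 4 ℕ.* 4) n%4≡3))
%4≡3⇒^odd {n} n%4≡3 (suc h) with j , eq ← %4≡3⇒^odd {n} n%4≡3 h =
  6 ℕ.+ 9 ℕ.* j ℕ.+ 6 ℕ.* q ℕ.* (3 ℕ.+ 4 ℕ.* j) ℕ.+ 4 ℕ.* q ℕ.* q ℕ.* (3 ℕ.+ 4 ℕ.* j) , ≡.trans (≡.cong₂ (λ a b → a ℕ.* (a ℕ.* b)) n≡ eq) (arrange q j)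
  where
  q = n ℕ./ 4
  n≡ : n ≡ 3 ℕ.+ q ℕ.* 4
  n≡ = ≡.trans (ℕ.m≡m%n+[m/n]*n n 4) (≡.cong (ℕ._+ n ℕ./ 4 ℕ.* 4) n%4≡3)
  arrange : ∀ q j → (3 ℕ.+ q ℕ.* 4) ℕ.* ((3 ℕ.+ q ℕ.* 4) ℕ.* (3 ℕ.+ j ℕ.* 4))
            ≡ 3 ℕ.+ (6 ℕ.+ 9 ℕ.* j ℕ.+ 6 ℕ.* q ℕ.* (3 ℕ.+ 4 ℕ.* j) ℕ.+ 4 ℕ.* q ℕ.* q ℕ.* (3 ℕ.+ 4 ℕ.* j)) ℕ.* 4
  arrange = solve-∀

-- A criterion for maximality and its two applications.

module _ {c ℓ} (K : FiniteField c ℓ) where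
  open FiniteField K hiding (zero)
  open FieldSums K
  open FieldArithmetic K
  open IntegerSolver commRing
  open import Relation.Binary.Reasoning.Setoid setoid

  size≢1 : size ≢ 1
  size≢1 size≡1 = 0≉1 (trans (sym (enum-index 0#)) (trans
    (reflexive (≡.cong enum (Fin-1-unique size≡1 (index 0#) (index 1#)))) (enum-index 1#)))
    where
    Fin-1-unique : ∀ {n} → n ≡ 1 → (i j : Fin n) → i ≡ j
    Fin-1-unique ≡.refl zero zero = ≡.refl

  -1^odd≈-1 : ∀ h → (- 1#) ^ suc (h ℕ.* 2) ≈ - 1#
  -1^odd≈-1 zero    = *-identityʳ _
  -1^odd≈-1 (suc h) = trans (*-congˡ (*-congˡ (-1^odd≈-1 h)))
    (solve 0 (:- con (+ 1) :* (:- con (+ 1) :* :- con (+ 1)) := :- con (+ 1)) refl)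

  -- A non-square g of K has g^((r²−1)/2) = −1, so k = g^((r+1)/4) satisfies k^(2(r−1)) = −1.
  ∃-antifixed-square : ∀ {r} j → r ≡ 3 ℕ.+ j ℕ.* 4 → size ≡ r ℕ.* r →
    ∃ λ k → ¬ k ≈ 0# × (k * k) ^ r ≈ - (k * k)
  ∃-antifixed-square {r} j ≡.refl size≡r*r = k , ^-≉0 (suc j) g≉0 , (begin
    (k * k) ^ r                              ≈⟨ ^-congˡ r (^-homo-* g (suc j) (suc j)) ⟨
    (g ^ (suc j ℕ.+ suc j)) ^ r              ≈⟨ ^-assocʳ g (suc j ℕ.+ suc j) r ⟩
    g ^ ((suc j ℕ.+ suc j) ℕ.* r)            ≡⟨ ≡.cong (g ^_) (exponent j) ⟩
    g ^ (h ℕ.+ (suc j ℕ.+ suc j))            ≈⟨ ^-homo-* g h (suc j ℕ.+ suc j) ⟩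
    u * g ^ (suc j ℕ.+ suc j)                ≈⟨ *-cong u≈-1 (^-homo-* g (suc j) (suc j)) ⟩
    - 1# * (k * k)                           ≈⟨ solve 1 (λ x → :- con (+ 1) :* x := :- x) refl (k * k) ⟩
    - (k * k)                                ∎)
    where
    open Polynomials K
    -- For r = 3 + 4j this is (r² - 1) / 2, and `suc j` is (r + 1) / 4.
    h : ℕ
    h = 4 ℕ.+ (8 ℕ.* j ℕ.* j ℕ.+ 12 ℕ.* j)
    exponent : ∀ j → (suc j ℕ.+ suc j) ℕ.* (3 ℕ.+ j ℕ.* 4) ≡ (4 ℕ.+ (8 ℕ.* j ℕ.* j ℕ.+ 12 ℕ.* j)) ℕ.+ (suc j ℕ.+ suc j)
    exponent = solve-∀
    size≡1+2h : size ≡ suc (h ℕ.+ h)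
    size≡1+2h = ≡.trans size≡r*r (square j)
      where
      square : ∀ j → (3 ℕ.+ j ℕ.* 4) ℕ.* (3 ℕ.+ j ℕ.* 4) ≡ suc ((4 ℕ.+ (8 ℕ.* j ℕ.* j ℕ.+ 12 ℕ.* j)) ℕ.+ (4 ℕ.+ (8 ℕ.* j ℕ.* j ℕ.+ 12 ℕ.* j)))
      square = solve-∀
    -- The polynomial x^(h + 1) - x has degree less than 2h + 1 = `size`, so some g is not a root.
    -- Then g ≠ 0 and g^h ≠ 1, while (g^h)² = 1; hence g^h = - 1.
    nonroot : ∃ λ x → ¬ x ^ suc h + (- 1# * x + 0#) ≈ 0#
    nonroot = non-root 1≉0 (Poly-trinomial {suc h} (s≤s (s≤s z≤n)) (- 1#) 0#)
      (ℕ.≤-trans (s≤s (ℕ.m<m+n h (s≤s z≤n))) (ℕ.≤-reflexive (≡.sym size≡1+2h)))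
    g = proj₁ nonroot
    u = g ^ h
    k = g ^ suc j
    g*u≉g : ¬ g * u ≈ g
    g*u≉g gu≈g = proj₂ nonroot (trans (+-congʳ gu≈g)
      (solve 1 (λ g → g :+ (:- con (+ 1) :* g :+ con (+ 0)) := con (+ 0)) refl g))
    g≉0 : ¬ g ≈ 0#
    g≉0 g≈0 = g*u≉g (trans (*-congʳ g≈0) (trans (zeroˡ u) (sym g≈0)))
    u*u≈1 : u * u ≈ 1#
    u*u≈1 = *-cancelˡ-≉0 g≉0 (begin
      g * (u * u)         ≈⟨ *-congˡ (^-homo-* g h h) ⟨
      g ^ suc (h ℕ.+ h)   ≡⟨ ≡.cong (g ^_) (≡.sym size≡1+2h) ⟩
      g ^ size            ≈⟨ x^size≈x g ⟩
      g                   ≈⟨ *-identityʳ g ⟨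
      g * 1#              ∎)
    u≈-1 : u ≈ - 1#
    u≈-1 = x+y≈0⇒x≈-y (x*y≈0⇒y≈0
      (λ u-1≈0 → g*u≉g (trans (*-congˡ (x-y≈0⇒x≈y u-1≈0)) (*-identityʳ g)))
      (trans (solve 1 (λ u → (u :- con (+ 1)) :* (u :+ con (+ 1)) := u :* u :- con (+ 1)) refl u) (x≈y⇒x-y≈0 u*u≈1)))

  module _ {p₀} (p₀-prime : Prime p₀) (2∤p₀ : ¬ 2 ∣ p₀) {k} (1≤k : 1 ≤ k)
           {α ζ} (α-fixed : α ^ (p₀ ℕ.^ k) ≈ α) (α≉0 : ¬ α ≈ 0#) (α≉-1 : ¬ α ≈ - 1#)
           (ζ-eq : ζ ^ (p₀ ℕ.^ k ℕ.∸ 1) ≈ betaOf K α) where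

    private
      p : ℕ
      p = p₀ ℕ.^ k
      β : Carrier
      β = betaOf K α

    2≤p₀ : 2 ≤ p₀
    2≤p₀ = ℕ.nonTrivial⇒n>1 p₀ {{prime⇒nonTrivial p₀-prime}}

    2≤p : 2 ≤ p
    2≤p = ℕ.≤-trans 2≤p₀ (ℕ.≤-trans (ℕ.≤-reflexive (≡.sym (ℕ.*-identityʳ p₀)))
      (ℕ.^-monoʳ-≤ p₀ {{ℕ.>-nonZero (ℕ.≤-trans (s≤s z≤n) 2≤p₀)}} 1≤k))

    p-odd : ∃ λ h → p ≡ suc (h ℕ.* 2)
    p-odd with h , ≡.refl ← odd-decomposition 2∤p₀ = odd-^ h k

    α+1≉0 : ¬ α + 1# ≈ 0#
    α+1≉0 = α≉-1 ∘ x+y≈0⇒x≈-y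

    β-relation : β * (α * (α + 1#)) ≈ - 1#
    β-relation = trans (sym (-‿distribˡ-* _ _)) (-‿cong (inv-l _ (*-≉0 α≉0 α+1≉0)))

    β≉0 : ¬ β ≈ 0#
    β≉0 β≈0 = 1≉0 (trans (sym (-‿involutive 1#)) (trans (-‿cong (trans (sym β-relation)
      (trans (*-congʳ β≈0) (zeroˡ _)))) -0#≈0#))

    ζ≉0 : ¬ ζ ≈ 0#
    ζ≉0 ζ≈0 = β≉0 (trans (sym ζ-eq) (trans (^-congˡ (p ℕ.∸ 1) ζ≈0)
      (0^n≈0 (p ℕ.∸ 1) {{ℕ.>-nonZero (ℕ.m<n⇒0<n∸m 2≤p)}})))

    ζᵖ≈βζ : ζ ^ p ≈ β * ζ
    ζᵖ≈βζ = trans (^-congʳ ζ (≡.sym (ℕ.m+[n∸m]≡n {1} {p} (ℕ.≤-trans (s≤s z≤n) 2≤p))))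
      (trans (*-congˡ ζ-eq) (*-comm _ _))

    -- The common core of both cases: m = 2d for odd d and m = d for even d. The last hypothesis is
    -- quantified over b because b = ζ ξ² involves the ξ found inside the proof; its factor β^s
    -- comes from b^p = β α² b and α^(2s) = 1.
    maximal-if : ∀ s m → size ≡ p ℕ.^ (s ℕ.+ s) → s ℕ.+ s ≡ p₀ ℕ.* m →
      α ^ m ≈ 1# → β ^ m ≈ 1# →
      (∀ {b} → b ^ (p ℕ.^ s) ≈ β ^ s * b → ∃ λ k → ¬ k ≈ 0# × (b * (k * k)) ^ (p ℕ.^ s) ≈ - (b * (k * k))) →
      Maximal K p ζ (p ℕ.^ s)
    -- For s = 0 the field would have a single element.
    maximal-if zero m size≡ _ _ _ _ = contradiction size≡ size≢1
    maximal-if s@(suc s′) m size≡ s+s≡p₀m α^m≈1 β^m≈1 twist =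
      let ξ , ξ≉0 , ξᵖ≈αξ = Tr.eigenvector α-fixed (x^∣≈1 (divides p₀ s+s≡p₀m) α^m≈1)
      in C.maximal α-fixed α≉0 β-relation ξ≉0 ξᵖ≈αξ ζᵖ≈βζ ζ≉0
          (T[b⁻¹]≈0 (bᵖ ξᵖ≈αξ) (*-≉0 ζ≉0 (*-≉0 ξ≉0 ξ≉0)))
          (twist (trans (F.eigen-^p^n s γ-fixed (bᵖ ξᵖ≈αξ)) (*-congʳ γ^s))) p-odd
      where
      p₀·1≈0 : p₀ · 1# ≈ 0#
      p₀·1≈0 = characteristic (k ℕ.* (s ℕ.+ s)) (≡.trans size≡ (ℕ.^-*-assoc p₀ k (s ℕ.+ s)))
      module Char = Characteristic p₀-prime p₀·1≈0
      ^p-+ : AdditivePower p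
      ^p-+ = Frobenius.^p^n-+ K p₀ 2≤p₀ Char.frobenius-+ k
      module F = Frobenius K p 2≤p ^p-+
      module Tr = F.Trace (s′ ℕ.+ s) size≡
      module C = Curve K p 2≤p ^p-+ (Char.2≉0 2∤p₀) s′ size≡

      γ : Carrier
      γ = β * (α * α)

      γ-fixed : F.Fixed γ
      γ-fixed = F.Fixed-* (F.Fixed-neg (F.Fixed-inv (*-≉0 α≉0 α+1≉0)
        (F.Fixed-* α-fixed (F.Fixed-+ α-fixed (1^n≈1 p))))) (F.Fixed-* α-fixed α-fixed)

      γ^ : ∀ n → γ ^ n ≈ β ^ n * (α ^ n * α ^ n)
      γ^ n = trans (^-distrib-* β (α * α) n) (*-congˡ (^-distrib-* α α n))

      γ^s : γ ^ s ≈ β ^ s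
      γ^s = trans (γ^ s) (trans (*-congˡ (trans (sym (^-homo-* α s s)) (x^∣≈1 (divides p₀ s+s≡p₀m) α^m≈1))) (*-identityʳ _))

      γ^m : γ ^ m ≈ 1#
      γ^m = trans (γ^ m) (trans (*-cong β^m≈1 (*-cong α^m≈1 α^m≈1)) (trans (*-identityˡ _) (*-identityˡ _)))

      bᵖ : ∀ {ξ} → ξ ^ p ≈ α * ξ → (ζ * (ξ * ξ)) ^ p ≈ γ * (ζ * (ξ * ξ))
      bᵖ {ξ} ξᵖ≈αξ = trans (^-distrib-* ζ _ p) (trans (*-cong ζᵖ≈βζ (trans (^-distrib-* ξ ξ p) (*-cong ξᵖ≈αξ ξᵖ≈αξ)))
        (solve 4 (λ α β ζ ξ → (β :* ζ) :* ((α :* ξ) :* (α :* ξ)) := (β :* (α :* α)) :* (ζ :* (ξ :* ξ))) refl α β ζ ξ))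

      -- Since γ^m = 1, b⁻¹ lies in the subfield of p^m elements, over which K has degree `p₀`. Its
      -- trace is therefore a multiple of `p₀`; this is the purpose of the factor `p₀` in the
      -- exponents of the theorem.
      T[b⁻¹]≈0 : ∀ {b} → b ^ p ≈ γ * b → ¬ b ≈ 0# → Tr.T (inv b) ≈ 0#
      T[b⁻¹]≈0 {b} bᵖ≈γb b≉0 = begin
        F.tr 1# (s ℕ.+ s) (inv b)     ≡⟨ ≡.cong (λ n → F.tr 1# n (inv b)) s+s≡p₀m ⟩
        F.tr 1# (p₀ ℕ.* m) (inv b)    ≈⟨ F.tr₁-subfield m (inv-^-fixed (p ℕ.^ m) b≉0
                                           (trans (F.eigen-^p^n m γ-fixed bᵖ≈γb) (trans (*-congʳ γ^m) (*-identityˡ b)))) p₀ ⟩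
        p₀ · F.tr 1# m (inv b)        ≈⟨ Char.q×x≈0 _ ⟩
        0#                            ∎

module _ {c ℓ} (K : FiniteField c ℓ) {p₀} (p₀-prime : Prime p₀) (2∤p₀ : ¬ 2 ∣ p₀) {k} (1≤k : 1 ≤ k) where
  open FiniteField K hiding (zero)
  open FieldArithmetic K
  open import Relation.Binary.Reasoning.Setoid setoid

  private
    p : ℕ
    p = p₀ ℕ.^ k

    p₀-odd = odd-decomposition 2∤p₀

  module Cases {α ζ : Carrier} (d : ℕ)
    (α-fixed : InFp K p α) (α≉0 : ¬ α ≈ 0#) (α≉-1 : ¬ α ≈ - 1#)
    (ζ-eq : pow K ζ (p ℕ.∸ 1) ≈ betaOf K α) (α^d≈1 : α ^ d ≈ 1#) (β^d≈1 : betaOf K α ^ d ≈ 1#) where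

    β : Carrier
    β = betaOf K α

    private
      criterion = maximal-if K p₀-prime 2∤p₀ 1≤k (pow⇒^ p α-fixed) α≉0 α≉-1 (pow⇒^ (p ℕ.∸ 1) ζ-eq)

    -- As d divides s = `p₀` d, β^s = 1 and b lies in F_r, so the sign must come from k. Both `p₀`
    -- and d are odd, so r = p^s is 3 modulo 4 and a suitable k exists.
    odd-case : ¬ 2 ∣ d → p ℕ.% 4 ≡ 3 → size ≡ p ℕ.^ (2 ℕ.* p₀ ℕ.* d) → Maximal K p ζ (p ℕ.^ (p₀ ℕ.* d))
    odd-case 2∤d p%4≡3 size≡ = criterion s (2 ℕ.* d) size≡′ (double p₀ d)
      (x^∣≈1 (ℕ.n∣m*n 2 {d}) α^d≈1) (x^∣≈1 (ℕ.n∣m*n 2 {d}) β^d≈1) twist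
      where
      s r : ℕ
      s = p₀ ℕ.* d
      r = p ℕ.^ s
      double : ∀ a b → a ℕ.* b ℕ.+ a ℕ.* b ≡ a ℕ.* (2 ℕ.* b)
      double = solve-∀
      2*s : ∀ a b → 2 ℕ.* a ℕ.* b ≡ a ℕ.* b ℕ.+ a ℕ.* b
      2*s = solve-∀
      size≡′ : size ≡ p ℕ.^ (s ℕ.+ s)
      size≡′ = ≡.trans size≡ (≡.cong (p ℕ.^_) (2*s p₀ d))

      r≡3[4] : ∃ λ j → r ≡ 3 ℕ.+ j ℕ.* 4
      r≡3[4] with h₀ , p₀≡ ← p₀-odd | h , d≡ ← odd-decomposition 2∤d
        with j , eq ← %4≡3⇒^odd {p} p%4≡3 (h₀ ℕ.+ h ℕ.+ 2 ℕ.* h₀ ℕ.* h) =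
        j , ≡.trans (≡.cong (p ℕ.^_) (≡.trans (≡.cong₂ ℕ._*_ p₀≡ d≡) (odd-* h₀ h))) eq

      twist : ∀ {b} → b ^ r ≈ β ^ s * b → ∃ λ k → ¬ k ≈ 0# × (b * (k * k)) ^ r ≈ - (b * (k * k))
      twist {b} bʳ≈ with j , r≡ ← r≡3[4]
        with k , k≉0 , anti ← ∃-antifixed-square K j r≡ (≡.trans size≡′ (ℕ.^-distribˡ-+-* p s s)) =
        k , k≉0 , (begin
          (b * (k * k)) ^ r        ≈⟨ ^-distrib-* b (k * k) r ⟩
          b ^ r * (k * k) ^ r      ≈⟨ *-cong (trans bʳ≈ (trans (*-congʳ (x^∣≈1 (ℕ.n∣m*n p₀ {d}) β^d≈1)) (*-identityˡ b))) anti ⟩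
          b * - (k * k)            ≈⟨ -‿distribʳ-* b (k * k) ⟨
          - (b * (k * k))          ∎)

    -- Here s = `p₀` (d / 2) and β^s = (- 1)^`p₀` = - 1 because `p₀` is odd. Thus b^r = - b already,
    -- and k = 1 serves.
    even-case : 2 ∣ d → pow K β (d ℕ./ 2) ≈ - 1# → size ≡ p ℕ.^ (p₀ ℕ.* d) → Maximal K p ζ (p ℕ.^ (p₀ ℕ.* (d ℕ./ 2)))
    even-case 2∣d β^half size≡ = criterion s d
      (≡.trans size≡ (≡.cong (p ℕ.^_) (≡.sym s+s≡p₀d))) s+s≡p₀d α^d≈1 β^d≈1
      λ {b} bʳ≈ → 1# , 1≉0 , (begin
        (b * (1# * 1#)) ^ r        ≈⟨ ^-congˡ r (b1 b) ⟩
        b ^ r                      ≈⟨ bʳ≈ ⟩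
        β ^ s * b                  ≈⟨ *-congʳ β^s≈-1 ⟩
        - 1# * b                   ≈⟨ -‿distribˡ-* 1# b ⟨
        - (1# * b)                 ≈⟨ -‿cong (trans (*-identityˡ b) (sym (b1 b))) ⟩
        - (b * (1# * 1#))          ∎)
      where
      q s r : ℕ
      q = d ℕ./ 2
      s = p₀ ℕ.* q
      r = p ℕ.^ s
      double : ∀ a b → a ℕ.* b ℕ.+ a ℕ.* b ≡ a ℕ.* (b ℕ.* 2)
      double = solve-∀
      s+s≡p₀d : s ℕ.+ s ≡ p₀ ℕ.* d
      s+s≡p₀d = ≡.trans (double p₀ q) (≡.cong (p₀ ℕ.*_) (ℕ.m/n*n≡m 2∣d))
      b1 : ∀ b → b * (1# * 1#) ≈ b
      b1 b = trans (*-congˡ (*-identityˡ 1#)) (*-identityʳ b)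
      β^s≈-1 : β ^ s ≈ - 1#
      β^s≈-1 with h , p₀≡ ← p₀-odd = begin
        β ^ (p₀ ℕ.* q)             ≡⟨ ≡.cong (β ^_) (ℕ.*-comm p₀ q) ⟩
        β ^ (q ℕ.* p₀)             ≈⟨ ^-assocʳ β q p₀ ⟨
        (β ^ q) ^ p₀               ≈⟨ ^-congˡ p₀ (pow⇒^ q β^half) ⟩
        (- 1#) ^ p₀                ≡⟨ ≡.cong ((- 1#) ^_) p₀≡ ⟩
        (- 1#) ^ suc (h ℕ.* 2)     ≈⟨ -1^odd≈-1 K h ⟩
        - 1#                       ∎

open import Data.Nat using (_*_; _^_; _/_; _%_; _∸_)

theorem7p6 : {c ℓ : Level} (p₀ k p : ℕ) → Prime p₀ → ¬ (2 ∣ p₀) → 1 ≤ k → p ≡ p₀ ^ k →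
    (K : FiniteField c ℓ) (α ζ : FiniteField.Carrier K) (d₁ d₂ d : ℕ) →
    InFp K p α → ¬ (FiniteField._≈_ K α (FiniteField.0# K)) →
    ¬ (FiniteField._≈_ K α (FiniteField.-_ K (FiniteField.1# K))) →
    FiniteField._≈_ K (pow K ζ (p ∸ 1)) (betaOf K α) →
    IsOrder K α d₁ → IsOrder K (betaOf K α) d₂ → d ≡ lcm d₁ d₂ →
    ((¬ (2 ∣ d) → p % 4 ≡ 3 → FiniteField.size K ≡ p ^ (2 * p₀ * d) →
    Maximal K p ζ (p ^ (p₀ * d)))
    × (2 ∣ d → FiniteField._≈_ K (pow K (betaOf K α) (d / 2)) (FiniteField.-_ K (FiniteField.1# K)) →
    FiniteField.size K ≡ p ^ (p₀ * d) → Maximal K p ζ (p ^ (p₀ * (d / 2)))))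
theorem7p6 p₀ k p p₀-prime 2∤p₀ 1≤k ≡.refl K α ζ d₁ d₂ d α-fixed α≉0 α≉-1 ζ-eq (_ , α^d₁≈1 , _) (_ , β^d₂≈1 , _) ≡.refl =
  odd-case , even-case
  where
  open FieldArithmetic K using (pow⇒^; x^∣≈1)
  open Cases K p₀-prime 2∤p₀ 1≤k d α-fixed α≉0 α≉-1 ζ-eq
    (x^∣≈1 (m∣lcm[m,n] d₁ d₂) (pow⇒^ d₁ α^d₁≈1)) (x^∣≈1 (n∣lcm[m,n] d₁ d₂) (pow⇒^ d₂ β^d₂≈1))
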